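{- Let $\mathcal{V}$ be a variety of Boolean algebras with operators of signature $\mathcal{O}$ that is closed under canonical extensions. Let $\mathcal{O}'$ be a finite subset of $\mathrm{Clo_{ex}}(\mathcal{O})$, the clone of all expanding terms over the signature $\mathcal{O}$, and let $\mathcal{V}'$ be the variety generated by term-reducts of members of $\mathcal{V}$ in the signature $\mathcal{O}'$. If $\mathcal{V}$ is coherent, then $\mathcal{V}'$ has equationally definable principal congruences (EDPC).
   Context: A Boolean algebra with operators is an algebra $\langle A,\wedge,\vee,\neg,0,1,\mathcal{O}\rangle$ such that $\langle A,\wedge,\vee,\neg,0,1\rangle$ is a Boolean algebra and $\mathcal{O}$ is a set of (multiplicative) operators, i.e. operations preserving existing finite meets in each coordinate (with appropriate dualisations of coordinates implicitly allowed). $\mathcal{O}$ is referred to as the signature; the Boolean operations are tacitly assumed always to be present (also for the signature $\mathcal{O}'$). Canonical extensions. A completion of a poset $P$ is a pair $\langle e,C\rangle$ where $C$ is a complete lattice and $e$ is an order embedding of $P$ into $C$ preserving all existing finite meets and joins of $P$. An element of $C$ is open (resp. closed) if it equals $\bigvee e(X)$ (resp. $\bigwedge e(X)$), taken in $C$, for some subset $X$ of $P$; $O$ and $K$ denote the sets of open and closed elements. The completion is dense if every element of $C$ is both a join of closed elements and a meet of open elements; it is compact if for any $A\subseteq K$ and $B\subseteq O$, $\bigwedge A\le\bigvee B$ if and only if there are finite subsets $A_0$ of $A$ and $B_0$ of $B$ with $\bigwedge A_0\le\bigvee B_0$. A dense and compact completion is called a canonical extension; every poset $P$ has one, unique up to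 a lattice isomorphism commuting with the embeddings, and it is denoted $P^\sigma$, with $P$ identified with its image. For a map $f\colon P\to Q$ between posets, the maps $f^\sigma,f^\pi\colon P^\sigma\to Q^\sigma$ are $$f^\sigma(x)=\bigvee\bigl\{\bigwedge\{f(a)\mid a\in P,\ p\le a\le q\}\mid p\in K,\ q\in O,\ p\le x\le q\bigr\},$$ $$f^\pi(x)=\bigwedge\bigl\{\bigvee\{f(a)\mid a\in P,\ p\le a\le q\}\mid p\in K,\ q\in O,\ p\le x\le q\bigr\},$$ where $K$ and $O$ are the sets of closed and open elements of $P^\sigma$. An $n$-ary operation on $P$ is extended by viewing it as a map $P^n\to P$ and identifying $(P^n)^\sigma$ with $(P^\sigma)^n$. Each operation $o$ in the signature is assigned, uniformly for the class of algebras considered, a canonical extension, $o^\sigma$ or $o^\pi$ (for the Boolean operations the two coincide and are the Boolean operations of the canonical extension, which is again a Boolean algebra). For $\mathbf{A}\in\mathcal{V}$, $\mathbf{A}^\sigma$ is the canonical extension of the poset reduct of $\mathbf{A}$ equipped with these extensions of the operations of $\mathbf{A}$. $\mathcal{V}$ is closed under canonical extensions if $\mathbf{A}\in\mathcal{V}$ implies $\mathbf{A}^\sigma\in\mathcal{V}$. A term $t$ is expanding (with respect to $\mathcal{V}$) if $t^{\mathbf{A}^\sigma}\ge(t^{\mathbf{A}})^\sigma$ for all $\mathbf{A}\in\mathcal{V}$ (pointwise), where $t^{\mathbf{A}^\sigma}$ is the term operation evaluated in $\mathbf{A}^\sigma$ and $(t^{\mathbf{A}})^\sigma$ is the $\sigma$-extension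 of the map $t^{\mathbf{A}}$. $\mathcal{V}$ is coherent if every finitely generated subalgebra of a finitely presented member of $\mathcal{V}$ is finitely presented (finitely presented: isomorphic to a quotient of a finitely generated free algebra of $\mathcal{V}$ by a finitely generated congruence). A variety has EDPC if there are finitely many pairs of $4$-variable terms $(p_i,q_i)$ such that for every member $\mathbf{A}$ and $a,b,c,d\in A$, $\langle c,d\rangle$ is in the congruence generated by $\langle a,b\rangle$ iff $p_i(a,b,c,d)=q_i(a,b,c,d)$ for all $i$.
   Formalization: The terms in O′ are additionally required to be multiplicative operators (coordinates possibly dualised) on all members of V, so that term-reducts are Boolean algebras with operators; for arbitrary expanding terms the claim is false. -}

module Defs where

open import Level using (Level; Lift; lift; 0ℓ; _⊔_) renaming (suc to lsuc)
open import Algebra.Lattice.Bundles using (BooleanAlgebra)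
open import Algebra.Lattice.Structures using (IsBooleanAlgebra)
import Algebra.Lattice.Properties.BooleanAlgebra as BooleanAlgebraProperties
open import Data.Fin.Base using (Fin)
open import Data.List.Base using (List; []; _∷_; map)
open import Data.List.Membership.Propositional using (_∈_)
open import Data.List.Relation.Unary.All using (All)
open import Data.Nat.Base using (ℕ)
open import Data.Product.Base using (Σ; ∃; ∃-syntax; _×_; _,_; proj₁; proj₂)
open import Data.Sum.Base using (_⊎_; inj₁; inj₂; [_,_])
open import Data.Vec.Functional using (Vector; updateAt) renaming ([] to ⟨⟩; _∷_ to _▹_)
open import Function.Base using (const; id; _∘_)
open import Function.Bundles using (Bijection; _⇔_)
open import Relation.Binary.Bundles using (Poset; Setoid)
open import Relation.Binary.Core using (Rel)
open import Relation.Unary using (Pred; _⊆_)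

------------------------------------------------------------------------
-- Universal algebra

record Signature (o : Level) : Set (lsuc o) where
  field
    Op    : Set o
    arity : Op → ℕ

open Signature public

record Algebra {o : Level} (S : Signature o) (c ℓ : Level) : Set (o ⊔ lsuc (c ⊔ ℓ)) where
  field
    setoid : Setoid c ℓ
  open Setoid setoid public
  field
    op      : (f : Op S) → Vector Carrier (arity S f) → Carrier
    op-cong : (f : Op S) {xs ys : Vector Carrier (arity S f)} →
              (∀ i → xs i ≈ ys i) → op f xs ≈ op f ys

data Term {o : Level} (S : Signature o) (X : Set) : Set o where
  var : X → Term S X
  app : (f : Op S) → Vector (Term S X) (arity S f) → Term S X

eval : ∀ {o c ℓ} {S : Signature o} (A : Algebra S c ℓ) {X : Set} →
       (X → Algebra.Carrier A) → Term S X → Algebra.Carrier A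
eval A ρ (var x)    = ρ x
eval A ρ (app f ts) = Algebra.op A f (λ i → eval A ρ (ts i))

substitute : ∀ {o} {S : Signature o} {X Y : Set} → (X → Term S Y) → Term S X → Term S Y
substitute σ (var x)    = σ x
substitute σ (app f ts) = app f (λ i → substitute σ (ts i))

-- A set of identities; identities are written in variables indexed by ℕ.
Theory : ∀ {o} → Signature o → (e : Level) → Set (o ⊔ lsuc e)
Theory S e = Rel (Term S ℕ) e

-- The variety (equational class) axiomatised by E.
Mod : ∀ {o e c ℓ} {S : Signature o} → Theory S e → Pred (Algebra S c ℓ) (o ⊔ e ⊔ c ⊔ ℓ)
Mod E A = ∀ s t → E s t → ∀ ρ → Algebra._≈_ A (eval A ρ s) (eval A ρ t)

-- The variety generated by a class of algebras: the intersection of all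
-- varieties containing the class.
VarietyGeneratedBy : ∀ {o c ℓ k} {S : Signature o} → Pred (Algebra S c ℓ) k →
                     Pred (Algebra S c ℓ) (lsuc (o ⊔ c ⊔ ℓ) ⊔ k)
VarietyGeneratedBy {o} {c} {ℓ} {k} {S} K B =
  (E : Theory S (o ⊔ c ⊔ ℓ)) → (∀ A → K A → Mod E A) → Mod E B

module _ {o c ℓ : Level} {S : Signature o} (A : Algebra S c ℓ) where
  open Algebra A

  -- The congruence of A generated by a relation R.
  data Cg {r : Level} (R : Rel Carrier r) : Rel Carrier (o ⊔ c ⊔ ℓ ⊔ r) where
    base      : ∀ {x y} → R x y → Cg R x y
    equal     : ∀ {x y} → x ≈ y → Cg R x y
    symmetric : ∀ {x y} → Cg R x y → Cg R y x
    transit   : ∀ {x y z} → Cg R x y → Cg R y z → Cg R x z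
    compat    : ∀ f {xs ys : Vector Carrier (arity S f)} →
                (∀ i → Cg R (xs i) (ys i)) → Cg R (op f xs) (op f ys)

  -- The finite relation with the listed pairs.
  pairs : List (Carrier × Carrier) → Rel Carrier c
  pairs L x y = (x , y) ∈ L

  quotient : ∀ {r} → Rel Carrier r → Algebra S c (o ⊔ c ⊔ ℓ ⊔ r)
  quotient R = record
    { setoid  = record
      { Carrier       = Carrier
      ; _≈_           = Cg R
      ; isEquivalence = record
        { refl = equal (Setoid.refl setoid) ; sym = symmetric ; trans = transit }
      }
    ; op      = op
    ; op-cong = compat
    }

  -- The subuniverse of A generated by a finite list of elements.
  data Generated (L : List Carrier) : Pred Carrier (o ⊔ c ⊔ ℓ) where
    generator : ∀ {x} → x ∈ L → Generated L x
    closed    : ∀ f {xs : Vector Carrier (arity S f)} →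
                (∀ i → Generated L (xs i)) → Generated L (op f xs)
    respects  : ∀ {x y} → x ≈ y → Generated L x → Generated L y

  subalgebra : List Carrier → Algebra S (o ⊔ c ⊔ ℓ) ℓ
  subalgebra L = record
    { setoid  = record
      { Carrier       = Σ Carrier (Generated L)
      ; _≈_           = λ x y → proj₁ x ≈ proj₁ y
      ; isEquivalence = record
        { refl  = Setoid.refl setoid
        ; sym   = Setoid.sym setoid
        ; trans = Setoid.trans setoid
        }
      }
    ; op      = λ f xs → op f (proj₁ ∘ xs) , closed f (proj₂ ∘ xs)
    ; op-cong = λ f p → op-cong f p
    }

record _≅_ {o c₁ ℓ₁ c₂ ℓ₂ : Level} {S : Signature o}
           (A : Algebra S c₁ ℓ₁) (B : Algebra S c₂ ℓ₂) : Set (o ⊔ c₁ ⊔ ℓ₁ ⊔ c₂ ⊔ ℓ₂) where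
  private
    module A = Algebra A
    module B = Algebra B
  field
    bijection : Bijection A.setoid B.setoid
  open Bijection bijection public using (to)
  field
    homomorphic : ∀ f xs → to (A.op f xs) B.≈ B.op f (to ∘ xs)

-- Equational consequence of E (Birkhoff's calculus).
data Derivable {o e : Level} {S : Signature o} (E : Theory S e) {X : Set} :
               Rel (Term S X) (o ⊔ e) where
  axiom     : ∀ {s t} → E s t → (σ : ℕ → Term S X) →
              Derivable E (substitute σ s) (substitute σ t)
  identity  : ∀ {t} → Derivable E t t
  symmetric : ∀ {s t} → Derivable E s t → Derivable E t s
  transit   : ∀ {s t u} → Derivable E s t → Derivable E t u → Derivable E s u
  compat    : ∀ f {ss ts : Vector (Term S X) (arity S f)} →
              (∀ i → Derivable E (ss i) (ts i)) → Derivable E (app f ss) (app f ts)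

-- The free algebra of Mod E on X: terms modulo the identities of the variety.
Free : ∀ {o e} {S : Signature o} → Theory S e → Set → Algebra S o (o ⊔ e)
Free {S = S} E X = record
  { setoid  = record
    { Carrier       = Term S X
    ; _≈_           = Derivable E
    ; isEquivalence = record { refl = identity ; sym = symmetric ; trans = transit }
    }
  ; op      = app
  ; op-cong = compat
  }

FinitelyPresented : ∀ {o e c ℓ} {S : Signature o} → Theory S e →
                    Pred (Algebra S c ℓ) (o ⊔ e ⊔ c ⊔ ℓ)
FinitelyPresented {S = S} E A =
  ∃[ n ] Σ (List (Term S (Fin n) × Term S (Fin n))) λ L →
    A ≅ quotient (Free E (Fin n)) (pairs (Free E (Fin n)) L)

Coherent : ∀ {ℓ} {S : Signature ℓ} → Theory S ℓ → Set (lsuc ℓ)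
Coherent {ℓ} {S} E = (A : Algebra S ℓ ℓ) → Mod E A → FinitelyPresented E A →
  (L : List (Algebra.Carrier A)) → FinitelyPresented E (subalgebra A L)

EDPC : ∀ {o c ℓ k} {S : Signature o} → Pred (Algebra S c ℓ) k → Set (o ⊔ lsuc (c ⊔ ℓ) ⊔ k)
EDPC {S = S} K =
  Σ (List (Term S (Fin 4) × Term S (Fin 4))) λ L →
    ∀ A → K A → let open Algebra A in ∀ a b c d →
      Cg A (pairs A ((a , b) ∷ [])) c d
        ⇔ All (λ (p , q) → eval A (a ▹ b ▹ c ▹ d ▹ ⟨⟩) p ≈ eval A (a ▹ b ▹ c ▹ d ▹ ⟨⟩) q) L

------------------------------------------------------------------------
-- Boolean algebras with operators

data BoolOp : Set where
  and or not top bot : BoolOp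

boolArity : BoolOp → ℕ
boolArity and = 2
boolArity or  = 2
boolArity not = 1
boolArity top = 0
boolArity bot = 0

withBool : ∀ {o} → Signature o → Signature o
withBool S = record { Op = BoolOp ⊎ Op S ; arity = [ boolArity , arity S ] }

module BoolOps {o c ℓ : Level} {S : Signature o} (A : Algebra (withBool S) c ℓ) where
  open Algebra A

  infixr 7 _∧_
  infixr 6 _∨_
  infix  8 ¬_

  _∧_ _∨_ : Carrier → Carrier → Carrier
  x ∧ y = op (inj₁ and) (x ▹ y ▹ ⟨⟩)
  x ∨ y = op (inj₁ or)  (x ▹ y ▹ ⟨⟩)

  ¬_ : Carrier → Carrier
  ¬ x = op (inj₁ not) (x ▹ ⟨⟩)

  ⊤ ⊥ : Carrier
  ⊤ = op (inj₁ top) ⟨⟩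
  ⊥ = op (inj₁ bot) ⟨⟩

IsBoolean : ∀ {o c ℓ} {S : Signature o} → Pred (Algebra (withBool S) c ℓ) (c ⊔ ℓ)
IsBoolean A = IsBooleanAlgebra _≈_ _∨_ _∧_ ¬_ ⊤ ⊥
  where open Algebra A; open BoolOps A

-- A coordinate of an operator is either taken in the order of the algebra
-- or dualised.
data Polarity : Set where
  direct dual : Polarity

Polarities : ∀ {o} → Signature o → Set o
Polarities S = (f : Op S) → Fin (arity S f) → Polarity

module _ {o c ℓ : Level} {S : Signature o} (A : Algebra (withBool S) c ℓ) where
  open Algebra A
  open BoolOps A

  meet : Polarity → Carrier → Carrier → Carrier
  meet direct = _∧_
  meet dual   = _∨_

  unit : Polarity → Carrier
  unit direct = ⊤
  unit dual   = ⊥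

  -- Preservation of finite meets in each coordinate, split into binary meets
  -- and the empty meet (every finite meet exists in a Boolean algebra).
  record IsOperator {n : ℕ} (π : Fin n → Polarity) (f : Vector Carrier n → Carrier) :
                    Set (c ⊔ ℓ) where
    field
      preserves-meet : ∀ xs i x y →
        f (updateAt xs i (const (meet (π i) x y))) ≈
        f (updateAt xs i (const x)) ∧ f (updateAt xs i (const y))
      preserves-unit : ∀ xs i → f (updateAt xs i (const (unit (π i)))) ≈ ⊤

record IsBAO {o c ℓ : Level} {S : Signature o} (π : Polarities S)
             (A : Algebra (withBool S) c ℓ) : Set (o ⊔ c ⊔ ℓ) where
  field
    isBoolean  : IsBoolean A
    isOperator : ∀ f → IsOperator A (π f) (Algebra.op A (inj₂ f))

posetReduct : ∀ {o c ℓ} {S : Signature o} (A : Algebra (withBool S) c ℓ) →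
              IsBoolean A → Poset c ℓ ℓ
posetReduct A b = BooleanAlgebraProperties.poset booleanAlgebra
  where
  booleanAlgebra : BooleanAlgebra _ _
  booleanAlgebra = record { isBooleanAlgebra = b }

------------------------------------------------------------------------
-- Canonical extensions

module _ {c ℓ₁ ℓ₂ : Level} (P : Poset c ℓ₁ ℓ₂) where
  open Poset P

  IsLUB IsGLB : ∀ {s} → Pred Carrier s → Carrier → Set (c ⊔ ℓ₂ ⊔ s)
  IsLUB S m = (∀ x → S x → x ≤ m) × (∀ u → (∀ x → S x → x ≤ u) → m ≤ u)
  IsGLB S m = (∀ x → S x → m ≤ x) × (∀ u → (∀ x → S x → u ≤ x) → u ≤ m)

-- Subsets of the lattice are predicates one universe up, so that sets such as
-- { c | c is closed } below, which quantify over subsets, have joins and meets.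
record CompleteLattice (ℓ : Level) : Set (lsuc (lsuc ℓ)) where
  field
    poset : Poset ℓ ℓ ℓ
  open Poset poset public
  field
    ⋁ ⋀   : Pred Carrier (lsuc ℓ) → Carrier
    ⋁-lub : ∀ S → IsLUB poset S (⋁ S)
    ⋀-glb : ∀ S → IsGLB poset S (⋀ S)

-- { f a | a ∈ X }
image : ∀ {a b s} {A : Set a} {B : Poset b b b} → (A → Poset.Carrier B) → Pred A s →
        Pred (Poset.Carrier B) (lsuc b ⊔ a ⊔ s)
image {b = b} {B = B} f X y = Lift (lsuc b) (∃[ a ] X a × Poset._≈_ B y (f a))

-- The power Cⁿ, with the coordinatewise order.
power : ∀ {ℓ} → CompleteLattice ℓ → ℕ → CompleteLattice ℓ
power {ℓ} C n = record
  { poset = record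
    { Carrier        = Vector Carrier n
    ; _≈_            = λ xs ys → ∀ i → xs i ≈ ys i
    ; _≤_            = λ xs ys → ∀ i → xs i ≤ ys i
    ; isPartialOrder = record
      { isPreorder = record
        { isEquivalence = record
          { refl  = λ i → Eq.refl
          ; sym   = λ p i → Eq.sym (p i)
          ; trans = λ p q i → Eq.trans (p i) (q i)
          }
        ; reflexive = λ p i → reflexive (p i)
        ; trans     = λ p q i → trans (p i) (q i)
        }
      ; antisym = λ p q i → antisym (p i) (q i)
      }
    }
  ; ⋁     = λ S i → ⋁ (image {B = poset} (λ xs → xs i) S)
  ; ⋀     = λ S i → ⋀ (image {B = poset} (λ xs → xs i) S)
  ; ⋁-lub = λ S →
      (λ xs s i → proj₁ (⋁-lub _) (xs i) (lift (xs , s , Eq.refl))) ,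
      (λ u h i → proj₂ (⋁-lub _) (u i)
        (λ { x (lift (xs , s , eq)) → trans (reflexive eq) (h xs s i) }))
  ; ⋀-glb = λ S →
      (λ xs s i → proj₁ (⋀-glb _) (xs i) (lift (xs , s , Eq.refl))) ,
      (λ u h i → proj₂ (⋀-glb _) (u i)
        (λ { x (lift (xs , s , eq)) → trans (h xs s i) (reflexive (Eq.sym eq)) }))
  }
  where open CompleteLattice C

-- Open and closed elements of C, relative to a map e into C.
module _ {ℓ : Level} {P : Set ℓ} (C : CompleteLattice ℓ) (e : P → CompleteLattice.Carrier C) where
  open CompleteLattice C

  IsOpen IsClosed : Pred Carrier (lsuc ℓ)
  IsOpen   c = Σ (Pred P ℓ) λ X → c ≈ ⋁ (image {B = poset} e X)
  IsClosed c = Σ (Pred P ℓ) λ X → c ≈ ⋀ (image {B = poset} e X)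

record Completion {ℓ : Level} (P : Poset ℓ ℓ ℓ) : Set (lsuc (lsuc ℓ)) where
  private module P = Poset P
  field
    lattice : CompleteLattice ℓ
  private module C = CompleteLattice lattice
  field
    embed           : P.Carrier → C.Carrier
    order-embedding : ∀ x y → x P.≤ y ⇔ embed x C.≤ embed y
    preserves-meets : ∀ xs m → IsGLB P (_∈ xs) m → IsGLB C.poset (_∈ map embed xs) (embed m)
    preserves-joins : ∀ xs m → IsLUB P (_∈ xs) m → IsLUB C.poset (_∈ map embed xs) (embed m)

module _ {ℓ : Level} {P : Poset ℓ ℓ ℓ} (κ : Completion P) where
  open Completion κ
  open CompleteLattice lattice

  private
    K O : Pred Carrier (lsuc ℓ)
    K = IsClosed lattice embed
    O = IsOpen lattice embed

  IsDense : Set (lsuc (lsuc ℓ))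
  IsDense = ∀ c → (Σ (Pred Carrier (lsuc ℓ)) λ S → S ⊆ K × c ≈ ⋁ S)
                × (Σ (Pred Carrier (lsuc ℓ)) λ S → S ⊆ O × c ≈ ⋀ S)

  IsCompact : Set (lsuc (lsuc ℓ))
  IsCompact = (A B : Pred Carrier (lsuc ℓ)) → A ⊆ K → B ⊆ O →
    ⋀ A ≤ ⋁ B ⇔
      (Σ (List Carrier) λ A₀ → Σ (List Carrier) λ B₀ → All A A₀ × All B B₀ ×
        ⋀ (image {B = poset} id (_∈ A₀)) ≤ ⋁ (image {B = poset} id (_∈ B₀)))

record CanonicalExtension {ℓ : Level} (P : Poset ℓ ℓ ℓ) : Set (lsuc (lsuc ℓ)) where
  field
    completion : Completion P
    dense      : IsDense completion
    compact    : IsCompact completion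
  open Completion completion public

-- The maps f^σ and f^π, for f : P → Q, e : P → C and e′ : Q → D.
module MapExtension {ℓ : Level} {P Q : Set ℓ} (C D : CompleteLattice ℓ)
  (e : P → CompleteLattice.Carrier C) (e′ : Q → CompleteLattice.Carrier D) where

  private
    module C = CompleteLattice C
    module D = CompleteLattice D

    values : (P → Q) → C.Carrier × C.Carrier → Pred D.Carrier (lsuc ℓ)
    values f (p , q) = image {B = D.poset} (e′ ∘ f) (λ a → p C.≤ e a × e a C.≤ q)

    interval : C.Carrier → Pred (C.Carrier × C.Carrier) (lsuc ℓ)
    interval x (p , q) = IsClosed C e p × IsOpen C e q × p C.≤ x × x C.≤ q

    interval-resp : ∀ {x y} → x C.≈ y → interval x ⊆ interval y
    interval-resp x≈y (k , o , p≤x , x≤q) =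
      k , o , C.trans p≤x (C.reflexive x≈y) , C.trans (C.reflexive (C.Eq.sym x≈y)) x≤q

  σ-extension π-extension : (P → Q) → C.Carrier → D.Carrier
  σ-extension f x = D.⋁ (image {B = D.poset} (D.⋀ ∘ values f) (interval x))
  π-extension f x = D.⋀ (image {B = D.poset} (D.⋁ ∘ values f) (interval x))

  private
    σ-mono : ∀ f {x y} → x C.≈ y → σ-extension f x D.≤ σ-extension f y
    σ-mono f x≈y = proj₂ (D.⋁-lub _) _ λ where
      d (lift (pq , i , eq)) → proj₁ (D.⋁-lub _) d (lift (pq , interval-resp x≈y i , eq))

    π-mono : ∀ f {x y} → x C.≈ y → π-extension f x D.≤ π-extension f y
    π-mono f x≈y = proj₂ (D.⋀-glb _) _ λ where
      d (lift (pq , i , eq)) →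
        proj₁ (D.⋀-glb _) d (lift (pq , interval-resp (C.Eq.sym x≈y) i , eq))

  σ-cong : ∀ f {x y} → x C.≈ y → σ-extension f x D.≈ σ-extension f y
  σ-cong f x≈y = D.antisym (σ-mono f x≈y) (σ-mono f (C.Eq.sym x≈y))

  π-cong : ∀ f {x y} → x C.≈ y → π-extension f x D.≈ π-extension f y
  π-cong f x≈y = D.antisym (π-mono f x≈y) (π-mono f (C.Eq.sym x≈y))

-- An n-ary operation on P is a map Pⁿ → P, and (Pⁿ)^σ is (P^σ)ⁿ, into which
-- Pⁿ embeds coordinatewise.
module OperationExtension {ℓ : Level} {P : Poset ℓ ℓ ℓ} (κ : CanonicalExtension P) (n : ℕ) where
  open CanonicalExtension κ
  open MapExtension {P = Vector (Poset.Carrier P) n} {Q = Poset.Carrier P}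
         (power lattice n) lattice (embed ∘_) embed public

data ExtensionType : Set where
  σ π : ExtensionType

-- The extension of the Boolean operations is fixed to be the σ-extension,
-- which for them equals the π-extension.
extensionType : ∀ {o} {S : Signature o} → (Op S → ExtensionType) → Op (withBool S) → ExtensionType
extensionType ε = [ const σ , ε ]

module _ {ℓ : Level} {S : Signature ℓ} (ε : Op S → ExtensionType)
         (A : Algebra (withBool S) ℓ ℓ) (b : IsBoolean A)
         (κ : CanonicalExtension (posetReduct A b)) where
  open CanonicalExtension κ using (lattice)
  open CompleteLattice lattice
  open OperationExtension κ

  private
    extend : ExtensionType → (n : ℕ) → (Vector (Algebra.Carrier A) n → Algebra.Carrier A) →
             Vector Carrier n → Carrier
    extend σ n = σ-extension n
    extend π n = π-extension n

    extend-cong : ∀ τ n f {xs ys : Vector Carrier n} → (∀ i → xs i ≈ ys i) →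
                  extend τ n f xs ≈ extend τ n f ys
    extend-cong σ n = σ-cong n
    extend-cong π n = π-cong n

  canonicalAlgebra : Algebra (withBool S) ℓ ℓ
  canonicalAlgebra = record
    { setoid  = record { isEquivalence = isEquivalence }
    ; op      = λ f → extend (extensionType {S = S} ε f) (arity (withBool S) f) (Algebra.op A f)
    ; op-cong = λ f → extend-cong (extensionType {S = S} ε f) (arity (withBool S) f) (Algebra.op A f)
    }

------------------------------------------------------------------------
-- Varieties of Boolean algebras with operators

record BAOVariety (ℓ : Level) : Set (lsuc ℓ) where
  field
    signature  : Signature ℓ
    polarities : Polarities signature
    extension  : Op signature → ExtensionType
    theory     : Theory (withBool signature) ℓ
    isBAO      : (A : Algebra (withBool signature) ℓ ℓ) → Mod theory A → IsBAO polarities A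

  Members : Pred (Algebra (withBool signature) ℓ ℓ) ℓ
  Members = Mod theory

  isBooleanMember : ∀ A → Members A → IsBoolean A
  isBooleanMember A A∈V = IsBAO.isBoolean (isBAO A A∈V)

module _ {ℓ : Level} (V : BAOVariety ℓ) where
  open BAOVariety V

  ClosedUnderCanonicalExtensions : Set (lsuc (lsuc ℓ))
  ClosedUnderCanonicalExtensions =
    ∀ A (A∈V : Members A) (κ : CanonicalExtension (posetReduct A (isBooleanMember A A∈V))) →
      Members (canonicalAlgebra extension A (isBooleanMember A A∈V) κ)

  IsExpanding : ∀ {n} → Term (withBool signature) (Fin n) → Set (lsuc (lsuc ℓ))
  IsExpanding {n} t =
    ∀ A (A∈V : Members A) (κ : CanonicalExtension (posetReduct A (isBooleanMember A A∈V))) →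
      let open CompleteLattice (CanonicalExtension.lattice κ)
          open OperationExtension κ n
          Aσ = canonicalAlgebra extension A (isBooleanMember A A∈V) κ
      in ∀ (xs : Vector Carrier n) → σ-extension (λ as → eval A as t) xs ≤ eval Aσ xs t

  -- A finite family of terms, each with its arity.
  TermFamily : ℕ → Set ℓ
  TermFamily m = Fin m → ∃[ n ] Term (withBool signature) (Fin n)

  familySignature : ∀ {m} → TermFamily m → Signature 0ℓ
  familySignature {m} T = record { Op = Fin m ; arity = proj₁ ∘ T }

  module _ {m : ℕ} (T : TermFamily m) where

    termReduct : Algebra (withBool signature) ℓ ℓ → Algebra (withBool (familySignature T)) ℓ ℓ
    termReduct A = record
      { setoid  = Algebra.setoid A
      ; op      = λ { (inj₁ b) xs → Algebra.op A (inj₁ b) xs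
                    ; (inj₂ j) xs → eval A xs (proj₂ (T j)) }
      ; op-cong = λ { (inj₁ b) p → Algebra.op-cong A (inj₁ b) p
                    ; (inj₂ j) p → eval-cong p (proj₂ (T j)) }
      }
      where
      open Algebra A
      eval-cong : ∀ {X : Set} {ρ ρ′ : X → Carrier} → (∀ x → ρ x ≈ ρ′ x) →
                  ∀ t → eval A ρ t ≈ eval A ρ′ t
      eval-cong p (var x)    = p x
      eval-cong p (app f ts) = op-cong f (λ i → eval-cong p (ts i))

    data IsTermReduct : Pred (Algebra (withBool (familySignature T)) ℓ ℓ) (lsuc ℓ) where
      reduct : ∀ {A} → Members A → IsTermReduct (termReduct A)

    ReductVariety : Pred (Algebra (withBool (familySignature T)) ℓ ℓ) (lsuc ℓ)
    ReductVariety = VarietyGeneratedBy IsTermReduct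

-- Put step x = x ∧ ⋀ box x, where the boxes are the unary operators obtained
-- from the operators of O′ by filling all coordinates but one with the extreme
-- value, and let pow k be the k-th iterate of step.
--
-- In ⟨ x , z , y ∣ z ≤ y ≤ x , y ≤ step y ⟩ one has z ≤ pow k x for all k, and
-- these inequalities imply every equation that holds there between x and z:
-- in the canonical extension of ⟨ x , z ∣ z ≤ pow k x for all k ⟩ the variable
-- y can be interpreted by the closed element ⋀ pow k x, which lies below its
-- own step because the terms of O′ are expanding.  By coherence the
-- subalgebra generated by x and z is finitely presented, so some K is such
-- that z ≤ pow K x implies z ≤ pow (suc K) x throughout V; z = pow K x gives
-- pow K x ≤ pow (suc K) x.  This identity and those of Boolean algebras with
-- operators pass to V′, where (c , d) therefore lies in the congruence
-- generated by (a , b) iff c and d agree below pow K (a ↔ b).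

module Submission where

open import Defs
open import Axiom.ExcludedMiddle using (ExcludedMiddle)
open import Data.Product.Base using (Σ; ∃-syntax; _×_; _,_; proj₁; proj₂)
open import Level using (Level; Lift; lift; lower; 0ℓ; _⊔_) renaming (suc to lsuc)
open import Algebra.Lattice.Bundles using (BooleanAlgebra)
import Algebra.Lattice.Properties.BooleanAlgebra as BooleanAlgebraProperties
open import Algebra.Lattice.Structures using (IsBooleanAlgebra)
open import Data.Bool.Base using (Bool; T)
open import Data.Fin.Base using (Fin; zero; suc; toℕ)
open import Data.Fin.Properties using (_≟_)
open import Data.List.Base using (List; []; _∷_; _++_; foldr; lookup)
open import Data.List.Membership.Propositional using (_∈_)
open import Data.List.Membership.Propositional.Properties using (∈-map⁺; ∈-map⁻; ∈-++⁺ˡ; ∈-++⁺ʳ)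
open import Data.List.Relation.Unary.All as All using (All; []; _∷_)
open import Data.List.Relation.Unary.All.Properties using (++⁺)
open import Data.List.Relation.Unary.Any using (here; there; index)
open import Data.List.Relation.Unary.Any.Properties using (lookup-index)
open import Data.Nat.Base as ℕ using (ℕ; zero; suc)
open import Data.Nat.Properties as ℕ using (≤⇒≤′; z≤′n)
open import Data.Sum.Base using (inj₁; inj₂)
open import Data.Unit.Base using (tt) renaming (⊤ to Unit)
open import Data.Vec.Functional using (Vector; updateAt; tail; head) renaming ([] to ⟨⟩; _∷_ to _▹_)
open import Data.Vec.Functional.Properties using (updateAt-updates; updateAt-minimal)
open import Function.Base using (const; id; _∘_; flip)
open import Function.Bundles using (Bijection; Equivalence; _⇔_; mk⇔)
open import Relation.Binary.Bundles using (Poset)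
open import Relation.Binary.Core using (Rel)
open import Relation.Binary.Definitions using (Transitive)
open import Relation.Binary.Lattice using (IsLattice)
open import Relation.Binary.PropositionalEquality as ≡ using (_≡_)
import Relation.Binary.Reasoning.Setoid as SetoidReasoning
open import Relation.Nullary.Decidable.Core using (yes; no; ⌊_⌋; toWitness; fromWitness)
open import Relation.Unary using (Pred)

-- The stage `K` exists because a derivation is finite: an equation that follows from all the
-- relations `z ≤ pow k x` follows from finitely many of them, and these hold at `z = pow k c` for
-- every large `k`. A finite presentation involves finitely many such equations, so one stage serves
-- them all. Two obstacles shape the rest. Closure under canonical extensions speaks of given
-- extensions, so one has to be built. Its elements must stay in the universe of the algebra
-- although families of them live one universe higher; excluded middle brings predicates down to
-- truth values. Moreover, the extension, as a member of the variety, is ordered by its extended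
-- meet, while limits and expanding terms refer to the order of the complete lattice. The two orders
-- are compared below closed elements, which is enough: the left sides that occur are elements of
-- the algebra and the limit of the iterates.

-- Evaluation, presented algebras and quotients.

module _ {o c ℓ : Level} {S : Signature o} (A : Algebra S c ℓ) where
  open Algebra A

  eval-cong : ∀ {X : Set} {ρ ρ′ : X → Carrier} → (∀ x → ρ x ≈ ρ′ x) →
              ∀ t → eval A ρ t ≈ eval A ρ′ t
  eval-cong p (var x)    = p x
  eval-cong p (app f ts) = op-cong f (λ i → eval-cong p (ts i))

  eval-substitute : ∀ {X Y : Set} (ρ : Y → Carrier) (τ : X → Term S Y) t →
                    eval A ρ (substitute τ t) ≈ eval A (eval A ρ ∘ τ) t
  eval-substitute ρ τ (var x)    = refl
  eval-substitute ρ τ (app f ts) = op-cong f (λ i → eval-substitute ρ τ (ts i))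

  Derivable-sound : ∀ {e} {E : Theory S e} → Mod E A → ∀ {X : Set} {s t : Term S X} →
                    Derivable E s t → (ρ : X → Carrier) → eval A ρ s ≈ eval A ρ t
  Derivable-sound A∈E (axiom {s} {t} s~t τ) ρ =
    trans (eval-substitute ρ τ s)
      (trans (A∈E s t s~t _) (sym (eval-substitute ρ τ t)))
  Derivable-sound A∈E identity        ρ = refl
  Derivable-sound A∈E (symmetric p)   ρ = sym (Derivable-sound A∈E p ρ)
  Derivable-sound A∈E (transit p q)   ρ = trans (Derivable-sound A∈E p ρ) (Derivable-sound A∈E q ρ)
  Derivable-sound A∈E (compat f ps)   ρ = op-cong f (λ i → Derivable-sound A∈E (ps i) ρ)

  -- The universal property of a presented algebra: a valuation in a member that satisfies the
  -- relations `R` factors through the quotient of the free algebra.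
  Cg-sound : ∀ {e r} {E : Theory S e} → Mod E A → ∀ {X : Set} {R : Rel (Term S X) r}
             (ρ : X → Carrier) → (∀ {s t} → R s t → eval A ρ s ≈ eval A ρ t) →
             ∀ {s t} → Cg (Free E X) R s t → eval A ρ s ≈ eval A ρ t
  Cg-sound A∈E ρ sat (base p)      = sat p
  Cg-sound A∈E ρ sat (equal p)     = Derivable-sound A∈E p ρ
  Cg-sound A∈E ρ sat (symmetric p) = sym (Cg-sound A∈E ρ sat p)
  Cg-sound A∈E ρ sat (transit p q) = trans (Cg-sound A∈E ρ sat p) (Cg-sound A∈E ρ sat q)
  Cg-sound A∈E ρ sat (compat f ps) = op-cong f (λ i → Cg-sound A∈E ρ sat (ps i))

eval-homomorphic :
  ∀ {o c₁ ℓ₁ c₂ ℓ₂} {S : Signature o} (A : Algebra S c₁ ℓ₁) (B : Algebra S c₂ ℓ₂) →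
  let module A = Algebra A; module B = Algebra B in
  (h : A.Carrier → B.Carrier) → (∀ f xs → h (A.op f xs) B.≈ B.op f (h ∘ xs)) →
  ∀ {X : Set} (ρ : X → A.Carrier) t → h (eval A ρ t) B.≈ eval B (h ∘ ρ) t
eval-homomorphic A B h hom ρ (var x)    = Algebra.refl B
eval-homomorphic A B h hom ρ (app f ts) =
  Algebra.trans B (hom f _) (Algebra.op-cong B f (λ i → eval-homomorphic A B h hom ρ (ts i)))

module _ {o e r : Level} {S : Signature o} (E : Theory S e) {X : Set} (R : Rel (Term S X) r) where
  private
    F = quotient (Free E X) R
    open Algebra F

  eval-presented : ∀ {Y : Set} (ρ : Y → Term S X) t → eval F ρ t ≈ substitute ρ t
  eval-presented ρ (var x)    = refl
  eval-presented ρ (app f ts) = compat f (λ i → eval-presented ρ (ts i))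

  presented-Mod : Mod E F
  presented-Mod s t s~t ρ =
    trans (eval-presented ρ s) (trans (equal (axiom s~t ρ)) (sym (eval-presented ρ t)))

  eval-presented-var : ∀ t → eval F var t ≈ t
  eval-presented-var (var x)    = refl
  eval-presented-var (app f ts) = compat f (λ i → eval-presented-var (ts i))

quotient-eval : ∀ {o c ℓ r} {S : Signature o} (A : Algebra S c ℓ) (R : Rel (Algebra.Carrier A) r)
                {X : Set} (ρ : X → Algebra.Carrier A) t →
                Cg A R (eval A ρ t) (eval (quotient A R) ρ t)
quotient-eval A R = eval-homomorphic A (quotient A R) id (λ f xs → equal (Algebra.refl A))

≅-refl : ∀ {o c ℓ} {S : Signature o} (A : Algebra S c ℓ) → A ≅ A
≅-refl A = record
  { bijection   = record
    { to = id ; cong = id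
    ; bijective = id , λ y → y , id }
  ; homomorphic = λ f xs → Algebra.refl A
  }

-- The coordinates are changed one at a time.
coordinatewise : ∀ {a b r s n} {A : Set a} {B : Set b} (R : Fin n → Rel A r) (_~_ : Rel B s) →
  Transitive _~_ → (f : Vector A n → B) →
  (∀ {xs ys} → (∀ i → xs i ≡ ys i) → f xs ~ f ys) →
  (∀ xs i {x y} → R i x y → f (updateAt xs i (const x)) ~ f (updateAt xs i (const y))) →
  ∀ {xs ys} → (∀ i → R i (xs i) (ys i)) → f xs ~ f ys
coordinatewise {n = zero}  R _~_ trans f resp step p = resp λ ()
coordinatewise {n = suc n} R _~_ trans f resp step {xs} {ys} p =
  trans (resp λ { zero → ≡.refl ; (suc i) → ≡.refl })
    (trans (step xs zero (p zero))
      (trans (resp {ys = head ys ▹ tail xs} λ { zero → ≡.refl ; (suc i) → ≡.refl })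
        (trans (coordinatewise (R ∘ suc) _~_ trans (λ zs → f (head ys ▹ zs))
                 (λ q → resp λ { zero → ≡.refl ; (suc i) → q i })
                 (λ zs i r → trans (resp λ { zero → ≡.refl ; (suc j) → ≡.refl })
                   (trans (step (head ys ▹ zs) (suc i) r)
                     (resp λ { zero → ≡.refl ; (suc j) → ≡.refl })))
                 {tail xs} {tail ys} (p ∘ suc))
          (resp λ { zero → ≡.refl ; (suc i) → ≡.refl }))))

-- Boolean algebras with operators

module _ {o : Level} {S : Signature o} {X : Set} where
  infixr 7 _∧ₜ_
  infixr 6 _∨ₜ_
  infix  8 ¬ₜ_

  _∧ₜ_ _∨ₜ_ : Term (withBool S) X → Term (withBool S) X → Term (withBool S) X
  s ∧ₜ t = app (inj₁ and) (s ▹ t ▹ ⟨⟩)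
  s ∨ₜ t = app (inj₁ or)  (s ▹ t ▹ ⟨⟩)
  ¬ₜ_ : Term (withBool S) X → Term (withBool S) X
  ¬ₜ t = app (inj₁ not) (t ▹ ⟨⟩)

  ⊤ₜ ⊥ₜ : Term (withBool S) X
  ⊤ₜ = app (inj₁ top) ⟨⟩
  ⊥ₜ = app (inj₁ bot) ⟨⟩

  ⋀ₜ : ∀ {n} → Vector (Term (withBool S) X) n → Term (withBool S) X
  ⋀ₜ {zero}  ts = ⊤ₜ
  ⋀ₜ {suc n} ts = ts zero ∧ₜ ⋀ₜ (ts ∘ suc)

  -- Complementing at a dual coordinate makes every box monotone in its one variable, whatever the
  -- polarity.
  litₜ : Polarity → Term (withBool S) X → Term (withBool S) X
  litₜ direct t = t
  litₜ dual   t = ¬ₜ t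

  extremeₜ : Polarity → Term (withBool S) X
  extremeₜ direct = ⊥ₜ
  extremeₜ dual   = ⊤ₜ

-- The unary operators obtained from f by filling all coordinates but one with
-- the least value of their polarity.
module _ {o : Level} {S : Signature o} (π : Polarities S) where

  slotsₜ : ∀ f → Fin (arity S f) → Vector (Term (withBool S) Unit) (arity S f)
  slotsₜ f i = updateAt (extremeₜ ∘ π f) i (const (litₜ (π f i) (var tt)))

  boxₜ : ∀ f → Fin (arity S f) → Term (withBool S) Unit
  boxₜ f i = app (inj₂ f) (slotsₜ f i)

finiteSignature : ∀ {m} → (Fin m → ℕ) → Signature 0ℓ
finiteSignature {m} ar = record { Op = Fin m ; arity = ar }

module _ {m : ℕ} {ar : Fin m → ℕ} (π : Polarities (finiteSignature ar)) where

  -- The conjunct `var tt` makes the iterates decrease; finiteness of the signature makes the meet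
  -- of all boxes a term.
  stepₜ : Term (withBool (finiteSignature ar)) Unit
  stepₜ = var tt ∧ₜ ⋀ₜ (λ j → ⋀ₜ (λ i → boxₜ π j i))

  powₜ : ℕ → Term (withBool (finiteSignature ar)) Unit
  powₜ zero    = var tt
  powₜ (suc k) = substitute (const (powₜ k)) stepₜ

module _ {o c ℓ : Level} {S : Signature o} (A : Algebra S c ℓ) where
  open Algebra A

  updateAt-cong : ∀ {n} {xs ys : Vector Carrier n} {x y} → (∀ k → xs k ≈ ys k) → ∀ i → x ≈ y →
                  ∀ k → updateAt xs i (const x) k ≈ updateAt ys i (const y) k
  updateAt-cong p zero    q zero    = q
  updateAt-cong p zero    q (suc k) = p (suc k)
  updateAt-cong p (suc i) q zero    = p zero
  updateAt-cong p (suc i) q (suc k) = updateAt-cong (p ∘ suc) i q k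

  eval-updateAt : ∀ {X : Set} (ρ : X → Carrier) {n} (ts : Vector (Term S X) n) i t k →
    eval A ρ (updateAt ts i (const t) k) ≈ updateAt (eval A ρ ∘ ts) i (const (eval A ρ t)) k
  eval-updateAt ρ ts zero    t zero    = refl
  eval-updateAt ρ ts zero    t (suc k) = refl
  eval-updateAt ρ ts (suc i) t zero    = refl
  eval-updateAt ρ ts (suc i) t (suc k) = eval-updateAt ρ (ts ∘ suc) i t k

module EvalBool {o c ℓ : Level} {S : Signature o} (A : Algebra (withBool S) c ℓ)
                {X : Set} (ρ : X → Algebra.Carrier A) where
  open Algebra A
  open BoolOps A

  eval-∧ : ∀ s t → eval A ρ (s ∧ₜ t) ≈ eval A ρ s ∧ eval A ρ t
  eval-∧ s t = op-cong _ λ { zero → refl ; (suc zero) → refl }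

  eval-∨ : ∀ s t → eval A ρ (s ∨ₜ t) ≈ eval A ρ s ∨ eval A ρ t
  eval-∨ s t = op-cong _ λ { zero → refl ; (suc zero) → refl }

  eval-¬ : ∀ t → eval A ρ (¬ₜ t) ≈ ¬ eval A ρ t
  eval-¬ t = op-cong _ λ { zero → refl }

  eval-⊤ : eval A ρ ⊤ₜ ≈ ⊤
  eval-⊤ = op-cong _ λ ()

  eval-⊥ : eval A ρ ⊥ₜ ≈ ⊥
  eval-⊥ = op-cong _ λ ()

module BoolCong {o c ℓ : Level} {S : Signature o} (A : Algebra (withBool S) c ℓ) where
  open Algebra A
  open BoolOps A

  ∧-congruent : ∀ {x y u v} → x ≈ y → u ≈ v → x ∧ u ≈ y ∧ v
  ∧-congruent p q = op-cong _ λ { zero → p ; (suc zero) → q }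

  ∨-congruent : ∀ {x y u v} → x ≈ y → u ≈ v → x ∨ u ≈ y ∨ v
  ∨-congruent p q = op-cong _ λ { zero → p ; (suc zero) → q }

  ¬-congruent : ∀ {x y} → x ≈ y → ¬ x ≈ ¬ y
  ¬-congruent p = op-cong _ λ { zero → p }

module BooleanReduct {o c ℓ : Level} {S : Signature o} (A : Algebra (withBool S) c ℓ)
                     (isBoolean : IsBoolean A) where

  booleanAlgebra : BooleanAlgebra c ℓ
  booleanAlgebra = record { isBooleanAlgebra = isBoolean }

  open Algebra A public
  open BoolOps A public
  open BooleanAlgebraProperties booleanAlgebra public
    using ( poset; ∨-∧-isOrderTheoreticLattice; ∧-identityʳ; ∧-identityˡ; ∧-zeroˡ; ∧-idem
          ; ∨-identityˡ; ¬⊤≈⊥; deMorgan₁; deMorgan₂)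
  open BooleanAlgebra booleanAlgebra public
    using ( ∧-cong; ∨-cong; ¬-cong; ∧-congˡ; ∧-congʳ; ∨-congˡ; ∨-congʳ; ∧-comm; ∨-comm; ∧-assoc
          ; ∧-distribˡ-∨; ∨-distribˡ-∧; ∨-complementˡ; ∧-complementʳ)
  open Poset poset public using (_≤_)
  open IsLattice ∨-∧-isOrderTheoreticLattice public
    using (x∧y≤x; x∧y≤y; ∧-greatest; x≤x∨y; y≤x∨y; ∨-least; antisym)
    renaming (refl to ≤-refl; trans to ≤-trans; reflexive to ≤-reflexive)

  x≤⊤ : ∀ x → x ≤ ⊤
  x≤⊤ x = sym (∧-identityʳ x)

  ⊥≤x : ∀ x → ⊥ ≤ x
  ⊥≤x x = sym (∧-zeroˡ x)

  -- As in posetReduct, x ≤ y is the equation x ≈ x ∧ y.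
  ≤⇒∨≈ : ∀ {x y} → x ≤ y → x ∨ y ≈ y
  ≤⇒∨≈ {x} {y} p = antisym (∨-least p ≤-refl) (y≤x∨y x y)

  ¬-antitone : ∀ {x y} → x ≤ y → ¬ y ≤ ¬ x
  ¬-antitone {x} {y} p = begin
    ¬ y           ≈⟨ ¬-cong (trans (sym (≤⇒∨≈ p)) (∨-comm x y)) ⟩
    ¬ (y ∨ x)     ≈⟨ deMorgan₂ y x ⟩
    ¬ y ∧ ¬ x     ∎
    where open SetoidReasoning setoid

  ∧-¬∨ : ∀ x y → x ∧ (¬ x ∨ y) ≈ x ∧ y
  ∧-¬∨ x y = begin
    x ∧ (¬ x ∨ y)      ≈⟨ ∧-distribˡ-∨ x (¬ x) y ⟩
    x ∧ ¬ x ∨ x ∧ y    ≈⟨ ∨-congʳ (∧-complementʳ x) ⟩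
    ⊥ ∨ x ∧ y          ≈⟨ ∨-identityˡ _ ⟩
    x ∧ y              ∎
    where open SetoidReasoning setoid

  ¬∨-∧ : ∀ x y → ¬ x ∨ x ∧ y ≈ ¬ x ∨ y
  ¬∨-∧ x y = begin
    ¬ x ∨ x ∧ y            ≈⟨ ∨-distribˡ-∧ (¬ x) x y ⟩
    (¬ x ∨ x) ∧ (¬ x ∨ y)  ≈⟨ ∧-congʳ (∨-complementˡ x) ⟩
    ⊤ ∧ (¬ x ∨ y)          ≈⟨ ∧-identityˡ _ ⟩
    ¬ x ∨ y                ∎
    where open SetoidReasoning setoid

  infixr 5 _↔_
  _↔_ : Carrier → Carrier → Carrier
  x ↔ y = (¬ x ∨ y) ∧ (¬ y ∨ x)

  ∧-↔ : ∀ x y → x ∧ (x ↔ y) ≈ y ∧ (x ↔ y)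
  ∧-↔ x y = antisym
    (∧-greatest (≤-trans (∧-greatest (x∧y≤x _ _) (≤-trans (x∧y≤y _ _) (x∧y≤x _ _)))
      (≤-trans (≤-reflexive (∧-¬∨ x y)) (x∧y≤y _ _))) (x∧y≤y _ _))
    (∧-greatest (≤-trans (∧-greatest (x∧y≤x _ _) (≤-trans (x∧y≤y _ _) (x∧y≤y _ _)))
      (≤-trans (≤-reflexive (∧-¬∨ y x)) (x∧y≤y _ _))) (x∧y≤y _ _))

  ∧-agree : ∀ {u x y} → u ≤ x ↔ y → u ∧ x ≈ u ∧ y
  ∧-agree {u} {x} {y} p = begin
    u ∧ x              ≈⟨ ∧-congʳ p ⟩
    (u ∧ (x ↔ y)) ∧ x  ≈⟨ ∧-assoc _ _ _ ⟩
    u ∧ ((x ↔ y) ∧ x)  ≈⟨ ∧-congˡ (trans (∧-comm _ _) (trans (∧-↔ x y) (∧-comm _ _))) ⟩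
    u ∧ ((x ↔ y) ∧ y)  ≈⟨ ∧-assoc _ _ _ ⟨
    (u ∧ (x ↔ y)) ∧ y  ≈⟨ ∧-congʳ p ⟨
    u ∧ y              ∎
    where open SetoidReasoning setoid

  ↔-refl : ∀ x → x ↔ x ≈ ⊤
  ↔-refl x = trans (∧-cong (∨-complementˡ x) (∨-complementˡ x)) (∧-idem ⊤)

  eval-⋀-lower : ∀ {X : Set} (ρ : X → Carrier) {n} (ts : Vector (Term (withBool S) X) n) i →
                 eval A ρ (⋀ₜ ts) ≤ eval A ρ (ts i)
  eval-⋀-lower ρ ts zero    = ≤-trans (≤-reflexive (EvalBool.eval-∧ A ρ _ _)) (x∧y≤x _ _)
  eval-⋀-lower ρ ts (suc i) = ≤-trans (≤-reflexive (EvalBool.eval-∧ A ρ (ts zero) _))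
    (≤-trans (x∧y≤y _ _) (eval-⋀-lower ρ (ts ∘ suc) i))

  eval-⋀-greatest : ∀ {X : Set} (ρ : X → Carrier) {n} (ts : Vector (Term (withBool S) X) n) {x} →
                    (∀ i → x ≤ eval A ρ (ts i)) → x ≤ eval A ρ (⋀ₜ ts)
  eval-⋀-greatest ρ {zero}  ts h = ≤-trans (x≤⊤ _) (≤-reflexive (sym (EvalBool.eval-⊤ A ρ)))
  eval-⋀-greatest ρ {suc n} ts h =
    ≤-trans (∧-greatest (h zero) (eval-⋀-greatest ρ (ts ∘ suc) (h ∘ suc)))
      (≤-reflexive (sym (EvalBool.eval-∧ A ρ _ _)))

  lit : Polarity → Carrier → Carrier
  lit direct x = x
  lit dual   x = ¬ x

  extreme : Polarity → Carrier
  extreme direct = ⊥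
  extreme dual   = ⊤

  _⊑[_]_ : Carrier → Polarity → Carrier → Set ℓ
  x ⊑[ direct ] y = x ≤ y
  x ⊑[ dual   ] y = y ≤ x

  ⊑-refl : ∀ p {x} → x ⊑[ p ] x
  ⊑-refl direct = ≤-refl
  ⊑-refl dual   = ≤-refl

  extreme-least : ∀ p {x} → extreme p ⊑[ p ] x
  extreme-least direct = ⊥≤x _
  extreme-least dual   = x≤⊤ _

  lit-mono : ∀ p {x y} → x ≤ y → lit p x ⊑[ p ] lit p y
  lit-mono direct q = q
  lit-mono dual   q = ¬-antitone q

  lit-⊤ : ∀ p → lit p ⊤ ≈ unit A p
  lit-⊤ direct = refl
  lit-⊤ dual   = ¬⊤≈⊥

  ⊑⇒meet : ∀ p {x y} → x ⊑[ p ] y → x ≈ meet A p x y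
  ⊑⇒meet direct q = q
  ⊑⇒meet dual   q = sym (trans (∨-comm _ _) (≤⇒∨≈ q))

  -- At a dual coordinate, restricting to `u` means joining with `¬ u`, and `¬ u ∨ x` depends on `x`
  -- only through `u ∧ x`.
  meet-lit : ∀ p {u x y} → u ∧ x ≈ u ∧ y → meet A p (lit p u) x ≈ meet A p (lit p u) y
  meet-lit direct q = q
  meet-lit dual {u} {x} {y} q = trans (sym (¬∨-∧ u x)) (trans (∨-congˡ q) (¬∨-∧ u y))

  slots : ∀ {n} → (Fin n → Polarity) → Fin n → Carrier → Vector Carrier n
  slots p i u = updateAt (extreme ∘ p) i (const (lit (p i) u))

  slots-mono : ∀ {n} (p : Fin n → Polarity) i {u w} → u ≤ w → ∀ k → slots p i u k ⊑[ p k ] slots p i w k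
  slots-mono p zero    q zero    = lit-mono (p zero) q
  slots-mono p zero    q (suc k) = ⊑-refl (p (suc k))
  slots-mono p (suc i) q zero    = ⊑-refl (p zero)
  slots-mono p (suc i) q (suc k) = slots-mono (p ∘ suc) i q k

  -- With monotonicity of the operator this makes a box a lower bound of all values whose `i`-th
  -- argument is above `lit (p i) u`. Both the congruence below `u` and the estimate at the limit
  -- rest on it.
  slots-least : ∀ {n} (p : Fin n → Polarity) i {u} (xs : Vector Carrier n) →
                lit (p i) u ⊑[ p i ] xs i → ∀ k → slots p i u k ⊑[ p k ] xs k
  slots-least p zero    xs h zero    = h
  slots-least p zero    xs h (suc k) = extreme-least (p (suc k))
  slots-least p (suc i) xs h zero    = extreme-least (p zero)
  slots-least p (suc i) xs h (suc k) = slots-least (p ∘ suc) i (xs ∘ suc) h k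

  eval-lit : ∀ {X : Set} (ρ : X → Carrier) p t → eval A ρ (litₜ p t) ≈ lit p (eval A ρ t)
  eval-lit ρ direct t = refl
  eval-lit ρ dual   t = EvalBool.eval-¬ A ρ t

  eval-extreme : ∀ {X : Set} (ρ : X → Carrier) p → eval A ρ (extremeₜ p) ≈ extreme p
  eval-extreme ρ direct = EvalBool.eval-⊥ A ρ
  eval-extreme ρ dual   = EvalBool.eval-⊤ A ρ

module BAOProperties {o c ℓ : Level} {S : Signature o} (π : Polarities S) (A : Algebra (withBool S) c ℓ)
                     (isBAO : IsBAO π A) where
  open IsBAO isBAO
  open BooleanReduct A isBoolean public
  private module Operator f = IsOperator (isOperator f)

  pointwise : ∀ {n} {xs ys : Vector Carrier n} → (∀ i → xs i ≡ ys i) → ∀ i → xs i ≈ ys i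
  pointwise p i = ≡.subst (_ ≈_) (p i) refl

  updateAt-mono : ∀ f xs i {x y} → x ⊑[ π f i ] y →
    op (inj₂ f) (updateAt xs i (const x)) ≤ op (inj₂ f) (updateAt xs i (const y))
  updateAt-mono f xs i {x} {y} p = trans (op-cong (inj₂ f) (updateAt-cong A (λ _ → refl) i (⊑⇒meet (π f i) p)))
    (Operator.preserves-meet f xs i x y)

  op-mono : ∀ f {xs ys} → (∀ i → xs i ⊑[ π f i ] ys i) → op (inj₂ f) xs ≤ op (inj₂ f) ys
  op-mono f = coordinatewise (λ i x y → x ⊑[ π f i ] y) _≤_ ≤-trans (op (inj₂ f))
    (≤-reflexive ∘ op-cong (inj₂ f) ∘ pointwise) (updateAt-mono f)

  box : ∀ f → Fin (arity S f) → Carrier → Carrier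
  box f i u = op (inj₂ f) (slots (π f) i u)

  eval-box : ∀ f i u → eval A (const u) (boxₜ π f i) ≈ box f i u
  eval-box f i u = op-cong (inj₂ f) λ k → trans
    (eval-updateAt A (const u) (extremeₜ ∘ π f) i (litₜ (π f i) (var tt)) k)
    (updateAt-cong A (λ j → eval-extreme (const u) (π f j)) i (eval-lit (const u) (π f i) (var tt)) k)

  box-mono : ∀ f i {u w} → u ≤ w → box f i u ≤ box f i w
  box-mono f i p = op-mono f (slots-mono (π f) i p)

  box-⊤ : ∀ f i → box f i ⊤ ≈ ⊤
  box-⊤ f i = trans (op-cong (inj₂ f) (updateAt-cong A (λ _ → refl) i (lit-⊤ (π f i))))
    (Operator.preserves-unit f _ i)

  module _ {u : Carrier} (u≤box : ∀ f i → u ≤ box f i u) where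

    _θ_ : Rel Carrier ℓ
    x θ y = u ∧ x ≈ u ∧ y

    ∧-restrict : ∀ x y → u ∧ (x ∧ y) ≈ (u ∧ x) ∧ (u ∧ y)
    ∧-restrict x y = antisym
      (∧-greatest (∧-greatest (x∧y≤x _ _) (≤-trans (x∧y≤y _ _) (x∧y≤x _ _)))
                  (∧-greatest (x∧y≤x _ _) (≤-trans (x∧y≤y _ _) (x∧y≤y _ _))))
      (∧-greatest (≤-trans (x∧y≤x _ _) (x∧y≤x _ _))
        (∧-greatest (≤-trans (x∧y≤x _ _) (x∧y≤y _ _)) (≤-trans (x∧y≤y _ _) (x∧y≤y _ _))))

    ¬-restrict : ∀ x → u ∧ ¬ x ≈ u ∧ ¬ (u ∧ x)
    ¬-restrict x = sym (trans (∧-congˡ (deMorgan₁ u x)) (∧-¬∨ u (¬ x)))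

    -- Below u, the i-th coordinate may be met with u, because the operator
    -- is ≥ box f i u ≥ u when that coordinate is u.
    updateAt-θ : ∀ f xs i {x y} → x θ y →
      op (inj₂ f) (updateAt xs i (const x)) θ op (inj₂ f) (updateAt xs i (const y))
    updateAt-θ f xs i {x} {y} p = begin
      u ∧ F x                            ≈⟨ absorb x ⟩
      u ∧ F (meet A q (lit q u) x)       ≈⟨ ∧-congˡ (op-cong (inj₂ f) (updateAt-cong A (λ _ → refl) i (meet-lit q p))) ⟩
      u ∧ F (meet A q (lit q u) y)       ≈⟨ absorb y ⟨
      u ∧ F y                            ∎
      where
      open SetoidReasoning setoid
      q = π f i
      F : Carrier → Carrier
      F z = op (inj₂ f) (updateAt xs i (const z))
      u≤F : u ≤ F (lit q u)
      u≤F = ≤-trans (u≤box f i) (op-mono f (slots-least (π f) i _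
        (≡.subst (lit q u ⊑[ q ]_) (≡.sym (updateAt-updates i xs)) (⊑-refl q))))
      absorb : ∀ z → u ∧ F z ≈ u ∧ F (meet A q (lit q u) z)
      absorb z = begin
        u ∧ F z                          ≈⟨ ∧-congʳ u≤F ⟩
        (u ∧ F (lit q u)) ∧ F z          ≈⟨ ∧-assoc _ _ _ ⟩
        u ∧ (F (lit q u) ∧ F z)          ≈⟨ ∧-congˡ (Operator.preserves-meet f xs i _ _) ⟨
        u ∧ F (meet A q (lit q u) z)     ∎

    op-θ : ∀ f {xs ys} → (∀ i → xs i θ ys i) → op f xs θ op f ys
    op-θ (inj₂ f) = coordinatewise (λ _ → _θ_) _θ_ trans (op (inj₂ f))
      (∧-congˡ ∘ op-cong (inj₂ f) ∘ pointwise) (updateAt-θ f)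
    op-θ (inj₁ and) {xs} {ys} p = begin
      u ∧ op (inj₁ and) xs                      ≈⟨ ∧-congˡ (eta xs) ⟩
      u ∧ (xs zero ∧ xs (suc zero))             ≈⟨ ∧-restrict _ _ ⟩
      (u ∧ xs zero) ∧ (u ∧ xs (suc zero))       ≈⟨ ∧-cong (p zero) (p (suc zero)) ⟩
      (u ∧ ys zero) ∧ (u ∧ ys (suc zero))       ≈⟨ ∧-restrict _ _ ⟨
      u ∧ (ys zero ∧ ys (suc zero))             ≈⟨ ∧-congˡ (eta ys) ⟨
      u ∧ op (inj₁ and) ys                      ∎
      where
      open SetoidReasoning setoid
      eta : ∀ zs → op (inj₁ and) zs ≈ zs zero ∧ zs (suc zero)
      eta zs = op-cong _ λ { zero → refl ; (suc zero) → refl }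
    op-θ (inj₁ or) {xs} {ys} p = begin
      u ∧ op (inj₁ or) xs                       ≈⟨ ∧-congˡ (eta xs) ⟩
      u ∧ (xs zero ∨ xs (suc zero))             ≈⟨ ∧-distribˡ-∨ _ _ _ ⟩
      (u ∧ xs zero) ∨ (u ∧ xs (suc zero))       ≈⟨ ∨-cong (p zero) (p (suc zero)) ⟩
      (u ∧ ys zero) ∨ (u ∧ ys (suc zero))       ≈⟨ ∧-distribˡ-∨ _ _ _ ⟨
      u ∧ (ys zero ∨ ys (suc zero))             ≈⟨ ∧-congˡ (eta ys) ⟨
      u ∧ op (inj₁ or) ys                       ∎
      where
      open SetoidReasoning setoid
      eta : ∀ zs → op (inj₁ or) zs ≈ zs zero ∨ zs (suc zero)
      eta zs = op-cong _ λ { zero → refl ; (suc zero) → refl }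
    op-θ (inj₁ not) {xs} {ys} p = begin
      u ∧ op (inj₁ not) xs    ≈⟨ ∧-congˡ (eta xs) ⟩
      u ∧ ¬ xs zero           ≈⟨ ¬-restrict _ ⟩
      u ∧ ¬ (u ∧ xs zero)     ≈⟨ ∧-congˡ (¬-cong (p zero)) ⟩
      u ∧ ¬ (u ∧ ys zero)     ≈⟨ ¬-restrict _ ⟨
      u ∧ ¬ ys zero           ≈⟨ ∧-congˡ (eta ys) ⟨
      u ∧ op (inj₁ not) ys    ∎
      where
      open SetoidReasoning setoid
      eta : ∀ zs → op (inj₁ not) zs ≈ ¬ zs zero
      eta zs = op-cong _ λ { zero → refl }
    op-θ (inj₁ top) p = ∧-congˡ (op-cong _ λ ())
    op-θ (inj₁ bot) p = ∧-congˡ (op-cong _ λ ())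

    Cg-θ : ∀ {r} {R : Rel Carrier r} → (∀ {x y} → R x y → x θ y) → ∀ {x y} → Cg A R x y → x θ y
    Cg-θ h (base p)      = h p
    Cg-θ h (equal p)     = ∧-congˡ p
    Cg-θ h (symmetric p) = sym (Cg-θ h p)
    Cg-θ h (transit p q) = trans (Cg-θ h p) (Cg-θ h q)
    Cg-θ h (compat f ps) = op-θ f (λ i → Cg-θ h (ps i))

-- Iterates of `step` and the congruence generated by one pair.

module FiniteBAOProperties {c ℓ : Level} {m : ℕ} {ar : Fin m → ℕ} (π : Polarities (finiteSignature ar))
  (A : Algebra (withBool (finiteSignature ar)) c ℓ) (isBAO : IsBAO π A) where
  open BAOProperties π A isBAO public

  step : Carrier → Carrier
  step u = eval A (const u) (stepₜ π)

  pow : ℕ → Carrier → Carrier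
  pow k u = eval A (const u) (powₜ π k)

  step-cong : ∀ {u w} → u ≈ w → step u ≈ step w
  step-cong p = eval-cong A (const p) (stepₜ π)

  pow-suc : ∀ k u → pow (suc k) u ≈ step (pow k u)
  pow-suc k u = eval-substitute A (const u) (const (powₜ π k)) (stepₜ π)

  step-decreasing : ∀ u → step u ≤ u
  step-decreasing u = ≤-trans (≤-reflexive (EvalBool.eval-∧ A _ _ _)) (x∧y≤x _ _)

  step≤box : ∀ u f i → step u ≤ box f i u
  step≤box u f i = ≤-trans (≤-reflexive (EvalBool.eval-∧ A _ (var tt) _)) (≤-trans (x∧y≤y _ _)
    (≤-trans (eval-⋀-lower _ (λ j → ⋀ₜ (boxₜ π j)) f)
      (≤-trans (eval-⋀-lower _ (boxₜ π f) i) (≤-reflexive (eval-box f i u)))))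

  step-greatest : ∀ {x u} → x ≤ u → (∀ f i → x ≤ box f i u) → x ≤ step u
  step-greatest {x} {u} p q = ≤-trans
    (∧-greatest p (eval-⋀-greatest _ (λ j → ⋀ₜ (boxₜ π j)) λ f →
      eval-⋀-greatest _ (boxₜ π f) λ i → ≤-trans (q f i) (≤-reflexive (sym (eval-box f i u)))))
    (≤-reflexive (sym (EvalBool.eval-∧ A _ _ _)))

  step-mono : ∀ {u w} → u ≤ w → step u ≤ step w
  step-mono p = step-greatest (≤-trans (step-decreasing _) p)
    (λ f i → ≤-trans (step≤box _ f i) (box-mono f i p))

  step-⊤ : step ⊤ ≈ ⊤
  step-⊤ = antisym (x≤⊤ _) (step-greatest ≤-refl (λ f i → ≤-reflexive (sym (box-⊤ f i))))

  pow-decreasing : ∀ k u → pow (suc k) u ≤ pow k u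
  pow-decreasing k u = ≤-trans (≤-reflexive (pow-suc k u)) (step-decreasing _)

  pow-anti : ∀ j k u → j ℕ.≤′ k → pow k u ≤ pow j u
  pow-anti j k       u ℕ.≤′-refl     = ≤-refl
  pow-anti j (suc k) u (ℕ.≤′-step p) = ≤-trans (pow-decreasing k u) (pow-anti j k u p)

  pow-⊤ : ∀ k → pow k ⊤ ≈ ⊤
  pow-⊤ zero    = refl
  pow-⊤ (suc k) = trans (pow-suc k ⊤) (trans (step-cong (pow-⊤ k)) step-⊤)

  postfixpoint≤pow : ∀ {x y} → y ≤ x → y ≤ step y → ∀ k → y ≤ pow k x
  postfixpoint≤pow p q zero    = p
  postfixpoint≤pow p q (suc k) =
    ≤-trans q (≤-trans (step-mono (postfixpoint≤pow p q k)) (≤-reflexive (sym (pow-suc k _))))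

  -- On A / Cg(a , b) the element a ↔ b becomes ⊤, and so does its n-th iterate.
  principalCongruence : ∀ n → (∀ u → pow n u ≤ pow (suc n) u) → ∀ a b c d →
    Cg A (pairs A ((a , b) ∷ [])) c d ⇔ (pow n (a ↔ b) ∧ c ≈ pow n (a ↔ b) ∧ d)
  principalCongruence n stable a b c d = mk⇔
    (Cg-θ u≤box λ { (here ≡.refl) → ∧-agree u≤a↔b })
    (λ p → Q.trans (Q.sym (below c)) (Q.trans (equal p) (below d)))
    where
    u = pow n (a ↔ b)
    -- Stability makes `u` a post-fixed point of `step`, hence a lower bound of its own boxes;
    -- agreement below `u` is then a congruence, and it contains `(a , b)`.
    u≤box : ∀ f i → u ≤ box f i u
    u≤box f i = ≤-trans (stable _) (≤-trans (≤-reflexive (pow-suc n _)) (step≤box u f i))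
    u≤a↔b : u ≤ a ↔ b
    u≤a↔b = pow-anti 0 n _ (z≤′n)

    quo = quotient A (pairs A ((a , b) ∷ []))
    module Q where
      open Algebra quo public
      open BoolCong quo public
    a~b : a Q.≈ b
    a~b = base (here ≡.refl)
    ↔~⊤ : (a ↔ b) Q.≈ ⊤
    ↔~⊤ = Q.trans (Q.∧-congruent (Q.∨-congruent (Q.¬-congruent a~b) Q.refl)
            (Q.∨-congruent Q.refl a~b)) (equal (↔-refl b))
    u~⊤ : u Q.≈ ⊤
    u~⊤ = Q.trans (quotient-eval A _ _ (powₜ π n))
      (Q.trans (eval-cong quo (const ↔~⊤) (powₜ π n))
        (Q.trans (Q.sym (quotient-eval A _ _ (powₜ π n))) (equal (pow-⊤ n))))
    below : ∀ x → (u ∧ x) Q.≈ x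
    below x = Q.trans (Q.∧-congruent u~⊤ Q.refl) (equal (∧-identityˡ x))

-- Construction of canonical extensions

-- The filter generated by X, and the ideal when the order is reversed.
data Generate {a r x} {A : Set a} (_≼_ : Rel A r) (_∙_ : A → A → A) (ε : A) (X : Pred A x) :
              Pred A (a ⊔ r ⊔ x) where
  member : ∀ {b} → X b → Generate _≼_ _∙_ ε X b
  empty  : Generate _≼_ _∙_ ε X ε
  both   : ∀ {b c} → Generate _≼_ _∙_ ε X b → Generate _≼_ _∙_ ε X c → Generate _≼_ _∙_ ε X (b ∙ c)
  weaken : ∀ {b c} → b ≼ c → Generate _≼_ _∙_ ε X b → Generate _≼_ _∙_ ε X c

module _ {a r} {A : Set a} {_≼_ : Rel A r} {_∙_ : A → A → A} {ε : A} where

  generate-rec : ∀ {x q} {X : Pred A x} (Q : Pred A q) → (∀ {b} → X b → Q b) → Q ε →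
                 (∀ {b c} → Q b → Q c → Q (b ∙ c)) → (∀ {b c} → b ≼ c → Q b → Q c) →
                 ∀ {b} → Generate _≼_ _∙_ ε X b → Q b
  generate-rec Q g e m w (member x)   = g x
  generate-rec Q g e m w empty        = e
  generate-rec Q g e m w (both p q)   = m (generate-rec Q g e m w p) (generate-rec Q g e m w q)
  generate-rec Q g e m w (weaken l p) = w l (generate-rec Q g e m w p)

  generate-bind : ∀ {x y} {X : Pred A x} {Y : Pred A y} →
                  (∀ {b} → X b → Generate _≼_ _∙_ ε Y b) →
                  ∀ {b} → Generate _≼_ _∙_ ε X b → Generate _≼_ _∙_ ε Y b
  generate-bind g = generate-rec _ g empty both weaken

  generate-foldr : ∀ {x} {X : Pred A x} {xs} → (∀ {b} → b ∈ xs → Generate _≼_ _∙_ ε X b) →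
                   Generate _≼_ _∙_ ε X (foldr _∙_ ε xs)
  generate-foldr {xs = []}     h = empty
  generate-foldr {xs = x ∷ xs} h = both (h (here ≡.refl)) (generate-foldr (h ∘ there))

module Interpolation {ℓ : Level} {S : Signature ℓ} (A : Algebra (withBool S) ℓ ℓ) (b : IsBoolean A) where
  open BooleanReduct A b

  Up Down : ∀ {x} → Pred Carrier x → Pred Carrier (ℓ ⊔ x)
  Up   = Generate _≤_ _∧_ ⊤
  Down = Generate (flip _≤_) _∨_ ⊥

  -- The finitary form of `⋀ X ≤ ⋁ Y`: a finite meet from `X` lies below a finite join from `Y`,
  -- with `b` in between.
  Meets : ∀ {x y} → Pred Carrier x → Pred Carrier y → Set (ℓ ⊔ x ⊔ y)
  Meets X Y = ∃[ b ] Up X b × Down Y b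

  Meets-mono : ∀ {x x′ y y′} {X : Pred Carrier x} {X′ : Pred Carrier x′}
               {Y : Pred Carrier y} {Y′ : Pred Carrier y′} →
               (∀ {b} → X b → Up X′ b) → (∀ {b} → Y b → Down Y′ b) → Meets X Y → Meets X′ Y′
  Meets-mono f g (b , u , d) = b , generate-bind f u , generate-bind g d

  module _ (κ : CanonicalExtension (posetReduct A b)) where
    open CanonicalExtension κ using (lattice; embed)
    private module C = CompleteLattice lattice

    -- Given by universal properties, so that they apply to any element equal to such a bound, in
    -- particular to the coordinates of closed and open vectors.
    IsMeetOf IsJoinOf : Pred Carrier ℓ → C.Carrier → Set ℓ
    IsMeetOf X p = (∀ {a} → X a → p C.≤ embed a) × (∀ u → (∀ {a} → X a → u C.≤ embed a) → u C.≤ p)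
    IsJoinOf Y q = (∀ {a} → Y a → embed a C.≤ q) × (∀ u → (∀ {a} → Y a → embed a C.≤ u) → q C.≤ u)

    -- Compactness for one closed and one open element, phrased through their generating sets so
    -- that it delivers an element of the algebra between them.
    Interpolates : Set (lsuc ℓ)
    Interpolates = ∀ {X Y : Pred Carrier ℓ} {p q} → IsMeetOf X p → IsJoinOf Y q → p C.≤ q → Meets X Y

module CanonicalExtensionConstruction {ℓ : Level} (em : ExcludedMiddle (lsuc ℓ)) {S : Signature ℓ}
  (A : Algebra (withBool S) ℓ ℓ) (b : IsBoolean A) where

  open BooleanReduct A b
  open Interpolation A b

  ⋀-lower : ∀ {x xs} → x ∈ xs → foldr _∧_ ⊤ xs ≤ x
  ⋀-lower (here ≡.refl) = x∧y≤x _ _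
  ⋀-lower (there i)     = ≤-trans (x∧y≤y _ _) (⋀-lower i)

  ⋁-upper : ∀ {x xs} → x ∈ xs → x ≤ foldr _∨_ ⊥ xs
  ⋁-upper (here ≡.refl) = x≤x∨y _ _
  ⋁-upper (there i)     = ≤-trans (⋁-upper i) (y≤x∨y _ _)

  -- Subsets with values in `Bool` stay in the universe of `A`, so sets of sets of elements can be
  -- the elements of a `CompleteLattice ℓ`. Excluded middle decides the predicates of level `lsuc ℓ`
  -- that define meets and joins.
  Subset : Set ℓ → Set ℓ
  Subset A = A → Bool

  ⟦_⟧ : ∀ {A} → Subset A → Pred A 0ℓ
  ⟦ X ⟧ a = T (X a)

  abstract
    subset : ∀ {A} → Pred A (lsuc ℓ) → Subset A
    subset P a = ⌊ em {P a} ⌋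

    subset⁺ : ∀ {A} {P : Pred A (lsuc ℓ)} {a} → P a → ⟦ subset P ⟧ a
    subset⁺ = fromWitness

    subset⁻ : ∀ {A} {P : Pred A (lsuc ℓ)} {a} → ⟦ subset P ⟧ a → P a
    subset⁻ = toWitness

  singleton : Carrier → Subset Carrier
  singleton a = subset λ b → Lift (lsuc ℓ) (b ≡ a)

  Up-singleton : ∀ {a b} → Up ⟦ singleton a ⟧ b → a ≤ b
  Up-singleton {a} = generate-rec (a ≤_) (λ x → ≡.subst (a ≤_) (≡.sym (lower (subset⁻ x))) ≤-refl)
    (x≤⊤ a) ∧-greatest (λ l p → ≤-trans p l)

  Down-singleton : ∀ {a b} → Down ⟦ singleton a ⟧ b → b ≤ a
  Down-singleton {a} = generate-rec (_≤ a) (λ x → ≡.subst (_≤ a) (≡.sym (lower (subset⁻ x))) ≤-refl)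
    (⊥≤x a) ∨-least ≤-trans

  self : ∀ {a} → ⟦ singleton a ⟧ a
  self = subset⁺ (lift ≡.refl)

  -- A set W of subsets of the algebra stands for the meet of the open elements
  -- ⋁ Y with Y ∈ W, and X ⊩ W says that the closed element ⋀ X lies below it.
  Element : Set ℓ
  Element = Subset (Subset Carrier)

  infix 4 _⊩_ _⊑_

  _⊩_ : ∀ {x} → Pred Carrier x → Element → Set (ℓ ⊔ x)
  X ⊩ W = ∀ Y → ⟦ W ⟧ Y → Meets X ⟦ Y ⟧

  -- Codes are compared by the closed elements below them. With mutual `⊑` as equality this is the
  -- concept lattice of the relation `Meets` between closed and open elements, a code being any set
  -- of opens that determines the concept.
  _⊑_ : Rel Element ℓ
  W ⊑ W′ = ∀ (X : Subset Carrier) → ⟦ X ⟧ ⊩ W → ⟦ X ⟧ ⊩ W′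

  ⊩-mono : ∀ {x x′} {X : Pred Carrier x} {X′ : Pred Carrier x′} {W} →
           (∀ {b} → X b → Up X′ b) → X ⊩ W → X′ ⊩ W
  ⊩-mono f h Y y = Meets-mono f member (h Y y)

  lattice : CompleteLattice ℓ
  lattice = record
    { poset = record
      { Carrier        = Element
      ; _≈_            = λ W W′ → (W ⊑ W′) × (W′ ⊑ W)
      ; _≤_            = _⊑_
      ; isPartialOrder = record
        { isPreorder = record
          { isEquivalence = record
            { refl  = (λ _ h → h) , (λ _ h → h)
            ; sym   = λ (p , q) → q , p
            ; trans = λ (p , q) (p′ , q′) → (λ X → p′ X ∘ p X) , (λ X → q X ∘ q′ X)
            }
          ; reflexive = proj₁
          ; trans     = λ p q X → q X ∘ p X
          }
        ; antisym = _,_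
        }
      }
    ; ⋀ = λ S → subset λ Y → ∃[ W ] S W × ⟦ W ⟧ Y
    -- The open elements above all members of `S`, where being above `W` is tested on the closed
    -- elements below `W`.
    ; ⋁ = λ S → subset λ Y → ∀ W → S W → ∀ X → ⟦ X ⟧ ⊩ W → Meets ⟦ X ⟧ ⟦ Y ⟧
    ; ⋀-glb = λ S →
        (λ W s X h Y y → h Y (subset⁺ (W , s , y))) ,
        (λ U l X h Y y → let W , s , w = subset⁻ y in l W s X h Y w)
    ; ⋁-lub = λ S →
        (λ W s X h Y y → subset⁻ y W s X h) ,
        (λ U l X h Y y → h Y (subset⁺ λ W s X′ h′ → l W s X′ h′ Y y))
    }

  module C = CompleteLattice lattice

  embed : Carrier → Element
  embed a = subset λ Y → Lift (lsuc ℓ) (Down ⟦ Y ⟧ a)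

  ⊩-embed⁺ : ∀ {x} {X : Pred Carrier x} {a} → Up X a → X ⊩ embed a
  ⊩-embed⁺ u Y y = _ , u , lower (subset⁻ y)

  ⊩-embed⁻ : ∀ {x} {X : Pred Carrier x} {a} → X ⊩ embed a → Up X a
  -- The open element used as a test is `a` itself, in the form `⋁ {a}`.
  ⊩-embed⁻ h with b , u , d ← h _ (subset⁺ (lift (member self))) = weaken (Down-singleton d) u

  embed-mono : ∀ {a b} → a ≤ b → embed a ⊑ embed b
  embed-mono l X h = ⊩-embed⁺ (weaken l (⊩-embed⁻ h))

  ⊑-embed⁻ : ∀ {a W} → embed a ⊑ W → ∀ Y → ⟦ W ⟧ Y → Down ⟦ Y ⟧ a
  ⊑-embed⁻ l Y y with b , u , d ← l _ (⊩-embed⁺ (member self)) Y y = weaken (Up-singleton u) d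

  completion : Completion poset
  completion = record
    { lattice         = lattice
    ; embed           = embed
    ; order-embedding = λ x y → mk⇔ embed-mono
        (λ l → Up-singleton (⊩-embed⁻ (l (singleton x) (⊩-embed⁺ (member self)))))
    ; preserves-meets = λ xs m (below , greatest) →
        (λ w i → let x , x∈xs , eq = ∈-map⁻ embed i in
          ≡.subst (embed m ⊑_) (≡.sym eq) (embed-mono (below x x∈xs))) ,
        (λ U l X h → ⊩-embed⁺ (weaken (greatest _ λ x → ⋀-lower)
          (generate-foldr λ i → ⊩-embed⁻ (l _ (∈-map⁺ embed i) X h))))
    ; preserves-joins = λ xs m (above , least) →
        (λ w i → let x , x∈xs , eq = ∈-map⁻ embed i in
          ≡.subst (_⊑ embed m) (≡.sym eq) (embed-mono (above x x∈xs))) ,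
        (λ U l X h Y y → m , ⊩-embed⁻ h , weaken (least _ λ x → ⋁-upper)
          (generate-foldr λ i → ⊑-embed⁻ (l _ (∈-map⁺ embed i)) Y y))
    }

  IsK IsO : Pred Element (lsuc ℓ)
  IsK = IsClosed lattice embed
  IsO = IsOpen lattice embed

  closure interior : Pred Carrier ℓ → Element
  closure  X = C.⋀ (image {B = C.poset} embed X)
  interior Y = C.⋁ (image {B = C.poset} embed Y)

  -- This and the next three lemmas identify the closed and open elements of the completion with the
  -- sets they stand for: `Z` lies below `closure X` when its filter contains `X`, and `interior X`
  -- lies below `Y` when the ideal of `Y` contains `X`.
  ⊩-closure⁺ : ∀ {x} {Z : Pred Carrier x} {X : Pred Carrier ℓ} → (∀ {a} → X a → Up Z a) → Z ⊩ closure X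
  ⊩-closure⁺ {X = X} f Y y with subset⁻ y
  ... | W , lift (a , Xa , W≈ea) , w with b , u , d ← proj₂ W≈ea (singleton a) (⊩-embed⁺ (member self)) Y w
    = a , f Xa , weaken (Up-singleton u) d

  ⊩-closure⁻ : ∀ {Z : Subset Carrier} {X : Pred Carrier ℓ} → ⟦ Z ⟧ ⊩ closure X → ∀ {a} → X a → Up ⟦ Z ⟧ a
  ⊩-closure⁻ {Z} {X} h Xa =
    ⊩-embed⁻ (proj₁ (C.⋀-glb (image {B = C.poset} embed X)) _ (lift (_ , Xa , C.Eq.refl)) Z h)

  interior⁺ : ∀ {X : Pred Carrier ℓ} {Y} → (∀ {a} → X a → Down ⟦ Y ⟧ a) → ⟦ interior X ⟧ Y
  interior⁺ f = subset⁺ λ W (lift (a , Xa , W≈ea)) Z h → a , ⊩-embed⁻ (proj₁ W≈ea Z h) , f Xa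

  interior⁻ : ∀ {X : Pred Carrier ℓ} {Y} → ⟦ interior X ⟧ Y → ∀ {a} → X a → Down ⟦ Y ⟧ a
  interior⁻ y Xa with b , u , d ← subset⁻ y _ (lift (_ , Xa , C.Eq.refl)) _ (⊩-embed⁺ (member self))
    = weaken (Up-singleton u) d

  -- Both halves can be read off from the coding. `W` is tested by the sets `X` with `X ⊩ W`, whose
  -- closures lie below `W`, and it is coded by the sets `Y` it contains, whose interiors lie above
  -- `W`.
  isDense : IsDense completion
  isDense W =
    ( (λ V → IsK V × V ⊑ W) , proj₁
    , (λ X h Y y → subset⁻ y (closure (Lift ℓ ∘ ⟦ X ⟧))
        ((_ , C.Eq.refl) , λ Z z → ⊩-mono {W = W} (⊩-closure⁻ z ∘ lift) h)
        X (⊩-closure⁺ (member ∘ lower)))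
    , proj₂ (C.⋁-lub (λ V → IsK V × V ⊑ W)) W λ _ → proj₂ ) ,
    ( (λ V → IsO V × W ⊑ V) , proj₁
    , proj₂ (C.⋀-glb (λ V → IsO V × W ⊑ V)) W (λ _ → proj₂)
    , (λ X h Y y → h Y (subset⁺ (interior (Lift ℓ ∘ ⟦ Y ⟧) ,
        ( (_ , C.Eq.refl)
        , λ Z z Y′ y′ → Meets-mono member (interior⁻ y′ ∘ lift) (z Y y))
        , interior⁺ (member ∘ lower)))) )

  -- The generators of all members of `A` form `X`, and those of `B` form `Y`, so `⋀ A ≤ ⋁ B` makes
  -- the filter of `X` meet the ideal of `Y`. Membership in either is witnessed by finitely many
  -- generators, each supplied by one member.
  isCompact : IsCompact completion
  isCompact A B A⊆K B⊆O = mk⇔ ⇒ ⇐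
    where
    X Y : Subset Carrier
    X = subset λ a → ∃[ W ] Σ (A W) λ w → proj₁ (A⊆K w) a
    Y = subset λ a → ∃[ W ] Σ (B W) λ w → proj₁ (B⊆O w) a

    meetOf joinOf : List Element → Element
    meetOf L = C.⋀ (image {B = C.poset} id (_∈ L))
    joinOf L = C.⋁ (image {B = C.poset} id (_∈ L))

    meetOf-lower : ∀ {L W} → W ∈ L → meetOf L ⊑ W
    meetOf-lower i = proj₁ (C.⋀-glb _) _ (lift (_ , i , C.Eq.refl))

    joinOf-upper : ∀ {L W} → W ∈ L → W ⊑ joinOf L
    joinOf-upper i = proj₁ (C.⋁-lub _) _ (lift (_ , i , C.Eq.refl))

    meetOf-anti : ∀ {L L′ W} → (∀ {V} → V ∈ L → V ∈ L′) → meetOf L ⊑ W → meetOf L′ ⊑ W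
    meetOf-anti f p = C.trans (proj₂ (C.⋀-glb _) _ λ { V (lift (V′ , i , eq)) →
      C.trans (meetOf-lower (f i)) (C.reflexive (C.Eq.sym eq)) }) p

    joinOf-mono : ∀ {L L′ W} → (∀ {V} → V ∈ L → V ∈ L′) → W ⊑ joinOf L → W ⊑ joinOf L′
    joinOf-mono f p = C.trans p (proj₂ (C.⋁-lub _) _ λ { V (lift (V′ , i , eq)) →
      C.trans (C.reflexive eq) (joinOf-upper (f i)) })

    finiteMeet : ∀ {b} → Up ⟦ X ⟧ b → Σ (List Element) λ L → All A L × meetOf L ⊑ embed b
    finiteMeet = generate-rec {X = ⟦ X ⟧} (λ b → Σ (List Element) λ L → All A L × meetOf L ⊑ embed b)
      (λ x → let W , w , a = subset⁻ x in W ∷ [] , w ∷ [] ,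
        C.trans (meetOf-lower (here ≡.refl)) (C.trans (C.reflexive (proj₂ (A⊆K w)))
          (proj₁ (C.⋀-glb _) _ (lift (_ , a , C.Eq.refl)))))
      ([] , [] , λ Z h → ⊩-embed⁺ empty)
      (λ (L , l , p) (L′ , l′ , p′) → L ++ L′ , ++⁺ l l′ , λ Z h → ⊩-embed⁺ (both
        (⊩-embed⁻ (meetOf-anti {L = L} ∈-++⁺ˡ p Z h))
        (⊩-embed⁻ (meetOf-anti {L = L′} (∈-++⁺ʳ L) p′ Z h))))
      (λ a≤b (L , l , p) → L , l , C.trans p (embed-mono a≤b))

    finiteJoin : ∀ {b} → Down ⟦ Y ⟧ b → Σ (List Element) λ L → All B L × embed b ⊑ joinOf L
    finiteJoin = generate-rec {X = ⟦ Y ⟧} (λ b → Σ (List Element) λ L → All B L × embed b ⊑ joinOf L)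
      (λ x → let W , w , a = subset⁻ x in W ∷ [] , w ∷ [] ,
        C.trans (C.trans (proj₁ (C.⋁-lub _) _ (lift (_ , a , C.Eq.refl)))
          (C.reflexive (C.Eq.sym (proj₂ (B⊆O w))))) (joinOf-upper (here ≡.refl)))
      ([] , [] , λ Z h V v → ⊥ , ⊩-embed⁻ h , empty)
      (λ (L , l , p) (L′ , l′ , p′) → L ++ L′ , ++⁺ l l′ , λ Z h V v → _ , ⊩-embed⁻ h ,
        both (⊑-embed⁻ (joinOf-mono {L = L} ∈-++⁺ˡ p) V v)
             (⊑-embed⁻ (joinOf-mono {L = L′} (∈-++⁺ʳ L) p′) V v))
      (λ a≤b (L , l , p) → L , l , C.trans (embed-mono a≤b) p)

    ⇒ : C.⋀ A ⊑ C.⋁ B → Σ (List Element) λ A₀ → Σ (List Element) λ B₀ →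
        All A A₀ × All B B₀ × meetOf A₀ ⊑ joinOf B₀
    ⇒ l =
      let b , u , d = l X X⊩A Y Y∈B
          A₀ , a , p = finiteMeet u
          B₀ , b , q = finiteJoin d
      in A₀ , B₀ , a , b , C.trans p q
      where
      X⊩A : ⟦ X ⟧ ⊩ C.⋀ A
      X⊩A Z z with W , w , z′ ← subset⁻ z =
        proj₂ (proj₂ (A⊆K w)) X (⊩-closure⁺ λ Xa → member (subset⁺ (W , w , Xa))) Z z′

      Y∈B : ⟦ C.⋁ B ⟧ Y
      Y∈B = subset⁺ λ W w Z h →
        proj₁ (proj₂ (B⊆O w)) Z h Y (interior⁺ λ Xa → member (subset⁺ (W , w , Xa)))

    ⇐ : (Σ (List Element) λ A₀ → Σ (List Element) λ B₀ →
        All A A₀ × All B B₀ × meetOf A₀ ⊑ joinOf B₀) → C.⋀ A ⊑ C.⋁ B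
    ⇐ (A₀ , B₀ , a , b , l) = C.trans
      (proj₂ (C.⋀-glb _) _ λ { W (lift (V , i , eq)) →
        C.trans (proj₁ (C.⋀-glb A) _ (All.lookup a i)) (C.reflexive (C.Eq.sym eq)) })
      (C.trans l (proj₂ (C.⋁-lub _) _ λ { W (lift (V , i , eq)) →
        C.trans (C.reflexive eq) (proj₁ (C.⋁-lub B) _ (All.lookup b i)) }))

  κ : CanonicalExtension (posetReduct A b)
  κ = record { completion = completion ; dense = isDense ; compact = isCompact }

  -- `closure X` lies below `p` and `interior Y` above `q`, so `p ≤ q` becomes an inequality between
  -- them, which the coding turns into `Meets`.
  κ-interpolates : Interpolates κ
  κ-interpolates {X} {Y} (_ , glb) (_ , lub) p≤q =
    Meets-mono (member ∘ lower ∘ subset⁻) (member ∘ lower ∘ subset⁻) X⊩Y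
    where
    X′ Y′ : Subset Carrier
    X′ = subset (Lift (lsuc ℓ) ∘ X)
    Y′ = subset (Lift (lsuc ℓ) ∘ Y)
    X⊩p = glb (closure X) (λ x → proj₁ (C.⋀-glb _) _ (lift (_ , x , C.Eq.refl)))
      X′ (⊩-closure⁺ (member ∘ subset⁺ ∘ lift))
    X⊩Y = lub (interior Y) (λ y → proj₁ (C.⋁-lub _) _ (lift (_ , y , C.Eq.refl)))
      X′ (p≤q X′ X⊩p) Y′ (interior⁺ (member ∘ subset⁺ ∘ lift))

  abstract
    canonicalExtension : Σ (CanonicalExtension (posetReduct A b)) Interpolates
    canonicalExtension = κ , κ-interpolates

-- Extensions of operations at closed and open elements

module CanonicalProperties {ℓ : Level} {S : Signature ℓ} (ε : Op S → ExtensionType)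
  (A : Algebra (withBool S) ℓ ℓ) (b : IsBoolean A) (κ : CanonicalExtension (posetReduct A b))
  (interpolates : Interpolation.Interpolates A b κ) where

  open BooleanReduct A b
  open Interpolation A b
  open CanonicalExtension κ using (lattice; order-embedding; preserves-meets; preserves-joins)
    renaming (embed to e)
  module C = CompleteLattice lattice
  Aσ = canonicalAlgebra ε A b κ
  module Aσ = Algebra Aσ

  Meet-of Join-of : Pred Carrier ℓ → C.Carrier → Set ℓ
  Meet-of = IsMeetOf κ
  Join-of = IsJoinOf κ

  e-mono : ∀ {x y} → x ≤ y → e x C.≤ e y
  e-mono = Equivalence.to (order-embedding _ _)

  e-reflects : ∀ {x y} → e x C.≤ e y → x ≤ y
  e-reflects = Equivalence.from (order-embedding _ _)

  e-cong : ∀ {x y} → x ≈ y → e x C.≈ e y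
  e-cong p = C.antisym (e-mono (≤-reflexive p)) (e-mono (≤-reflexive (sym p)))

  e-injective : ∀ {x y} → e x C.≈ e y → x ≈ y
  e-injective p = antisym (e-reflects (C.reflexive p)) (e-reflects (C.reflexive (C.Eq.sym p)))

  e-∧-greatest : ∀ {u x y} → u C.≤ e x → u C.≤ e y → u C.≤ e (x ∧ y)
  e-∧-greatest {u} {x} {y} p q = proj₂ (preserves-meets (x ∷ y ∷ []) (x ∧ y)
    ( (λ { z (here ≡.refl) → x∧y≤x _ _ ; z (there (here ≡.refl)) → x∧y≤y _ _ })
    , λ z h → ∧-greatest (h x (here ≡.refl)) (h y (there (here ≡.refl))))) u
    λ { z (here ≡.refl) → p ; z (there (here ≡.refl)) → q }

  e-∨-least : ∀ {u x y} → e x C.≤ u → e y C.≤ u → e (x ∨ y) C.≤ u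
  e-∨-least {u} {x} {y} p q = proj₂ (preserves-joins (x ∷ y ∷ []) (x ∨ y)
    ( (λ { z (here ≡.refl) → x≤x∨y _ _ ; z (there (here ≡.refl)) → y≤x∨y _ _ })
    , λ z h → ∨-least (h x (here ≡.refl)) (h y (there (here ≡.refl))))) u
    λ { z (here ≡.refl) → p ; z (there (here ≡.refl)) → q }

  ≤e⊤ : ∀ {u} → u C.≤ e ⊤
  ≤e⊤ {u} = proj₂ (preserves-meets [] ⊤ ((λ _ ()) , λ x _ → x≤⊤ x)) u (λ _ ())

  e⊥≤ : ∀ {u} → e ⊥ C.≤ u
  e⊥≤ {u} = proj₂ (preserves-joins [] ⊥ ((λ _ ()) , λ x _ → ⊥≤x x)) u (λ _ ())

  Up-lower : ∀ {X : Pred Carrier ℓ} {p a} → Meet-of X p → Up X a → p C.≤ e a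
  Up-lower (below , _) = generate-rec _ below ≤e⊤ e-∧-greatest (λ l q → C.trans q (e-mono l))

  Down-upper : ∀ {Y : Pred Carrier ℓ} {q a} → Join-of Y q → Down Y a → e a C.≤ q
  Down-upper (above , _) = generate-rec _ above e⊥≤ e-∨-least (λ l p → C.trans (e-mono l) p)

  ⋀-Meet-of : ∀ X → Meet-of X (C.⋀ (image {B = C.poset} e X))
  ⋀-Meet-of X = (λ x → proj₁ (C.⋀-glb _) _ (lift (_ , x , C.Eq.refl))) ,
    λ u h → proj₂ (C.⋀-glb _) u λ { w (lift (a , x , eq)) → C.trans (h x) (C.reflexive (C.Eq.sym eq)) }

  ⋁-Join-of : ∀ Y → Join-of Y (C.⋁ (image {B = C.poset} e Y))
  ⋁-Join-of Y = (λ y → proj₁ (C.⋁-lub _) _ (lift (_ , y , C.Eq.refl))) ,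
    λ u h → proj₂ (C.⋁-lub _) u λ { w (lift (a , y , eq)) → C.trans (C.reflexive eq) (h y) }

  e-Meet-of : ∀ a → Meet-of (_≈ a) (e a)
  e-Meet-of a = (λ p → C.reflexive (e-cong (sym p))) , λ u h → h refl

  e-Join-of : ∀ a → Join-of (_≈ a) (e a)
  e-Join-of a = (λ p → C.reflexive (e-cong p)) , λ u h → h refl

  Up-≈ : ∀ {a x} → Up (_≈ a) x → a ≤ x
  Up-≈ {a} = generate-rec _ (λ p → ≤-reflexive (sym p)) (x≤⊤ a) ∧-greatest (λ l p → ≤-trans p l)

  module Power (n : ℕ) where
    module P = CompleteLattice (power lattice n)
    open OperationExtension κ n

    eᵛ : Vector Carrier n → P.Carrier
    eᵛ = e ∘_

    Closed Open : Pred P.Carrier (lsuc ℓ)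
    Closed = IsClosed (power lattice n) eᵛ
    Open   = IsOpen (power lattice n) eᵛ

    coordinate : Pred (Vector Carrier n) ℓ → Fin n → Pred Carrier ℓ
    coordinate X i a = ∃[ v ] X v × v i ≈ a

    ⋀ᵛ ⋁ᵛ : Pred (Vector Carrier n) ℓ → P.Carrier
    ⋀ᵛ X = P.⋀ (image {B = P.poset} eᵛ X)
    ⋁ᵛ X = P.⋁ (image {B = P.poset} eᵛ X)

    -- Bounds in the power are coordinatewise, so a closed vector has closed coordinates and
    -- interpolation applies to each of them.
    coordinate-Meet-of : ∀ {p} (k : Closed p) i → Meet-of (coordinate (proj₁ k) i) (p i)
    coordinate-Meet-of (X , eq) i =
      (λ { (v , x , vi≈a) → C.trans (C.reflexive (eq i))
        (C.trans (proj₁ (P.⋀-glb (image {B = P.poset} eᵛ X)) _ (lift (v , x , P.Eq.refl)) i)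
          (C.reflexive (e-cong vi≈a))) }) ,
      λ u h → C.trans (proj₂ (C.⋀-glb _) u λ { w (lift (xs , lift (v , x , xs≈ev) , w≈xsi)) →
        C.trans (h (v , x , refl)) (C.reflexive (C.Eq.sym (C.Eq.trans w≈xsi (xs≈ev i)))) })
        (C.reflexive (C.Eq.sym (eq i)))

    coordinate-Join-of : ∀ {q} (o : Open q) i → Join-of (coordinate (proj₁ o) i) (q i)
    coordinate-Join-of (Y , eq) i =
      (λ { (v , y , vi≈a) → C.trans (C.reflexive (e-cong (sym vi≈a)))
        (C.trans (proj₁ (P.⋁-lub (image {B = P.poset} eᵛ Y)) _ (lift (v , y , P.Eq.refl)) i)
          (C.reflexive (C.Eq.sym (eq i)))) }) ,
      λ u h → C.trans (C.reflexive (eq i))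
        (proj₂ (C.⋁-lub _) u λ { w (lift (xs , lift (v , y , xs≈ev) , w≈xsi)) →
          C.trans (C.reflexive (C.Eq.trans w≈xsi (xs≈ev i))) (h (v , y , refl)) })

    eᵛ-Closed : ∀ v → Closed (eᵛ v)
    eᵛ-Closed v = (λ w → ∀ i → w i ≈ v i) , P.antisym
      (proj₂ (P.⋀-glb _) (eᵛ v) λ { xs (lift (w , w≈v , eq)) i →
        C.reflexive (C.Eq.trans (e-cong (sym (w≈v i))) (C.Eq.sym (eq i))) })
      (proj₁ (P.⋀-glb _) _ (lift (v , (λ i → refl) , P.Eq.refl)))

    eᵛ-Open : ∀ v → Open (eᵛ v)
    eᵛ-Open v = (λ w → ∀ i → w i ≈ v i) , P.antisym
      (proj₁ (P.⋁-lub _) _ (lift (v , (λ i → refl) , P.Eq.refl)))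
      (proj₂ (P.⋁-lub _) (eᵛ v) λ { xs (lift (w , w≈v , eq)) i →
        C.reflexive (C.Eq.trans (eq i) (e-cong (w≈v i))) })

    -- Supplies entries for the coordinates that an argument leaves free, so that a vector inside a
    -- given interval can be completed.
    interpolant : ∀ {p q} → Closed p → Open q → p P.≤ q → ∀ i → ∃[ a ] p i C.≤ e a × e a C.≤ q i
    interpolant k o p≤q i =
      let a , u , d = interpolates (coordinate-Meet-of k i) (coordinate-Join-of o i) (p≤q i)
      in a , Up-lower (coordinate-Meet-of k i) u , Down-upper (coordinate-Join-of o i) d

    Between : P.Carrier → P.Carrier → Pred (Vector Carrier n) ℓ
    Between p q v = p P.≤ eᵛ v × eᵛ v P.≤ q

    σ-least : ∀ f {xs w} →
      (∀ {p q} → Closed p → Open q → p P.≤ xs → xs P.≤ q →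
        ∀ z → (∀ {v} → Between p q v → z C.≤ e (f v)) → z C.≤ w) →
      σ-extension f xs C.≤ w
    σ-least f h = proj₂ (C.⋁-lub _) _ λ { d (lift ((p , q) , (k , o , p≤xs , xs≤q) , eq)) →
      h k o p≤xs xs≤q d λ m →
        C.trans (C.reflexive eq) (proj₁ (C.⋀-glb _) _ (lift (_ , m , C.Eq.refl))) }

    σ-upper : ∀ f {xs w p q} → Closed p → Open q → p P.≤ xs → xs P.≤ q →
              (∀ {v} → Between p q v → w C.≤ e (f v)) → w C.≤ σ-extension f xs
    σ-upper f k o p≤xs xs≤q h = C.trans
      (proj₂ (C.⋀-glb _) _ λ { d (lift (v , m , eq)) → C.trans (h m) (C.reflexive (C.Eq.sym eq)) })
      (proj₁ (C.⋁-lub _) _ (lift (_ , (k , o , p≤xs , xs≤q) , C.Eq.refl)))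

    π-greatest : ∀ f {xs w} →
      (∀ {p q} → Closed p → Open q → p P.≤ xs → xs P.≤ q →
        ∀ z → (∀ {v} → Between p q v → e (f v) C.≤ z) → w C.≤ z) →
      w C.≤ π-extension f xs
    π-greatest f h = proj₂ (C.⋀-glb _) _ λ { d (lift ((p , q) , (k , o , p≤xs , xs≤q) , eq)) →
      h k o p≤xs xs≤q d λ m →
        C.trans (proj₁ (C.⋁-lub _) _ (lift (_ , m , C.Eq.refl))) (C.reflexive (C.Eq.sym eq)) }

    π-lower : ∀ f {xs w p q} → Closed p → Open q → p P.≤ xs → xs P.≤ q →
              (∀ {v} → Between p q v → e (f v) C.≤ w) → π-extension f xs C.≤ w
    π-lower f k o p≤xs xs≤q h = C.trans
      (proj₁ (C.⋀-glb _) _ (lift (_ , (k , o , p≤xs , xs≤q) , C.Eq.refl)))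
      (proj₂ (C.⋁-lub _) _ λ { d (lift (v , m , eq)) → C.trans (C.reflexive eq) (h m) })

    module _ (f : Vector Carrier n → Carrier)
             (f-cong : ∀ {xs ys} → (∀ i → xs i ≈ ys i) → f xs ≈ f ys) (v : Vector Carrier n) where

      -- `eᵛ v` is both closed and open, so the interval around it may shrink to `v` alone;
      -- therefore both extensions agree with `f` on the algebra.
      pinched : ∀ {w} → Between (eᵛ v) (eᵛ v) w → e (f w) C.≈ e (f v)
      pinched (p , q) = e-cong (f-cong λ i → antisym (e-reflects (q i)) (e-reflects (p i)))

      σ-extends : e (f v) C.≈ σ-extension f (eᵛ v)
      σ-extends = C.antisym
        (σ-upper f (eᵛ-Closed v) (eᵛ-Open v) P.refl P.refl λ m → C.reflexive (C.Eq.sym (pinched m)))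
        (σ-least f λ k o p q z h → h (p , q))

      π-extends : e (f v) C.≈ π-extension f (eᵛ v)
      π-extends = C.antisym
        (π-greatest f λ k o p q z h → h (p , q))
        (π-lower f (eᵛ-Closed v) (eᵛ-Open v) P.refl P.refl λ m → C.reflexive (pinched m))

  e-homomorphic : ∀ f xs → e (op f xs) C.≈ Aσ.op f (e ∘ xs)
  e-homomorphic (inj₁ f) xs = Power.σ-extends _ (op (inj₁ f)) (op-cong (inj₁ f)) xs
  e-homomorphic (inj₂ f) xs with ε f
  ... | σ = Power.σ-extends _ (op (inj₂ f)) (op-cong (inj₂ f)) xs
  ... | π = Power.π-extends _ (op (inj₂ f)) (op-cong (inj₂ f)) xs

  ∧σ-lower : ∀ x z → BoolOps._∧_ Aσ x z C.≤ x
  ∧σ-lower x z = σ-least (op (inj₁ and)) λ {p} {q} k o p≤xz xz≤q u h →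
    let below , glb = coordinate-Meet-of k zero
        inter = interpolant k o (P.trans {i = p} {x ▹ z ▹ ⟨⟩} {q} p≤xz xz≤q)
        a₀ , p≤a₀ , a₀≤q = inter zero
        a₁ , p≤a₁ , a₁≤q = inter (suc zero)
    -- A generator `a` of `p zero` may fail to lie below `q zero`; meeting it with the interpolant
    -- `a₀` keeps the vector inside the interval.
    in C.trans (glb u λ {a} i → C.trans
         (h {(a₀ ∧ a) ▹ a₁ ▹ ⟨⟩}
           ( (λ { zero → e-∧-greatest p≤a₀ (below i) ; (suc zero) → p≤a₁ })
           , (λ { zero → C.trans (e-mono (x∧y≤x _ _)) a₀≤q ; (suc zero) → a₁≤q })))
         (e-mono (≤-trans (x∧y≤x _ _) (x∧y≤y _ _)))) (p≤xz zero)
    where open Power 2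

  -- Passes from the order of the complete lattice to the order defined by the extended meet. For a
  -- closed `c` the constant vector `c` is itself an admissible lower end, and the interval from it
  -- up to `⊤` already forces the value to be at least `c`.
  closed-∧σ : ∀ {X c z} → Meet-of X c → c C.≤ z → c C.≈ BoolOps._∧_ Aσ c z
  closed-∧σ {X} {c} {z} (below , glb) c≤z = C.antisym
    (σ-upper (op (inj₁ and)) {p = const c} {q = eᵛ (const ⊤)}
      ((λ v → ∃[ a ] X a × (∀ i → v i ≈ a)) , P.antisym
        (proj₂ (P.⋀-glb _) (const c) λ { w (lift (v , (a , x , v≈a) , w≈ev)) i →
          C.trans (below x) (C.reflexive (C.Eq.sym (C.Eq.trans (w≈ev i) (e-cong (v≈a i))))) })
        (λ i → glb _ λ {a} x → proj₁ (P.⋀-glb _) (eᵛ (const a))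
          (lift (const a , (a , x , λ _ → refl) , P.Eq.refl)) i))
      (eᵛ-Open _)
      (λ { zero → C.refl ; (suc zero) → c≤z })
      (λ { zero → ≤e⊤ ; (suc zero) → ≤e⊤ })
      λ {v} (p , _) → C.trans (e-∧-greatest (p zero) (p (suc zero)))
        (C.reflexive (e-cong (op-cong _ λ { zero → refl ; (suc zero) → refl }))))
    (∧σ-lower c z)
    where open Power 2

  -- Limits of descending chains in the canonical extension.

  module Limit (D : ℕ → Carrier) (D-anti : ∀ {j k} → j ℕ.≤ k → D k ≤ D j) where

    chain cochain : Pred Carrier ℓ
    chain   a = ∃[ k ] a ≈ D k
    cochain a = ∃[ k ] a ≈ ¬ D k

    limit colimit : C.Carrier
    limit   = C.⋀ (image {B = C.poset} e chain)
    colimit = C.⋁ (image {B = C.poset} e cochain)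

    limit≤D : ∀ k → limit C.≤ e (D k)
    limit≤D k = proj₁ (⋀-Meet-of chain) (k , refl)

    ¬D≤colimit : ∀ k → e (¬ D k) C.≤ colimit
    ¬D≤colimit k = proj₁ (⋁-Join-of cochain) (k , refl)

    Up-chain : ∀ {a} → Up chain a → ∃[ k ] D k ≤ a
    Up-chain = generate-rec _ (λ (k , p) → k , ≤-reflexive (sym p)) (0 , x≤⊤ _) combine
      (λ l (k , p) → k , ≤-trans p l)
      where
      combine : ∀ {a b} → (∃[ k ] D k ≤ a) → (∃[ k ] D k ≤ b) → ∃[ k ] D k ≤ a ∧ b
      combine (j , p) (k , q) = j ℕ.⊔ k , ∧-greatest (≤-trans (D-anti (ℕ.m≤m⊔n j k)) p)
                                                     (≤-trans (D-anti (ℕ.m≤n⊔m j k)) q)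

    Down-cochain : ∀ {a} → Down cochain a → ∃[ k ] a ≤ ¬ D k
    Down-cochain = generate-rec _ (λ (k , p) → k , ≤-reflexive p) (0 , ⊥≤x _) combine
      (λ l (k , p) → k , ≤-trans l p)
      where
      combine : ∀ {a b} → (∃[ k ] a ≤ ¬ D k) → (∃[ k ] b ≤ ¬ D k) → ∃[ k ] a ∨ b ≤ ¬ D k
      combine (j , p) (k , q) = j ℕ.⊔ k ,
        ∨-least (≤-trans p (¬-antitone (D-anti (ℕ.m≤m⊔n j k))))
                (≤-trans q (¬-antitone (D-anti (ℕ.m≤n⊔m j k))))

    -- Interpolation, combined with the fact that every element of the filter generated by a
    -- descending chain is above a single member of the chain.
    limit≤open : ∀ {Y q} → Join-of Y q → limit C.≤ q → ∃[ k ] e (D k) C.≤ q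
    limit≤open j l =
      let a , u , d = interpolates (⋀-Meet-of chain) j l
          k , p = Up-chain u
      in k , C.trans (e-mono p) (Down-upper j d)

    limit≤e : ∀ {a} → limit C.≤ e a → ∃[ k ] D k ≤ a
    limit≤e l = let k , p = limit≤open (e-Join-of _) l in k , e-reflects p

    e≤colimit : ∀ {a} → e a C.≤ colimit → ∃[ k ] a ≤ ¬ D k
    e≤colimit l =
      let x , u , d = interpolates (e-Meet-of _) (⋁-Join-of cochain) l
          k , p = Down-cochain d
      in k , ≤-trans (Up-≈ u) p

    -- Every admissible interval around `limit` contains some `D j`, since its open upper end is
    -- reached at a finite stage; the value there is `¬ D j`.
    ¬limit≤colimit : BoolOps.¬_ Aσ limit C.≤ colimit
    ¬limit≤colimit = σ-least (op (inj₁ not)) λ k o p≤ ≤q z h →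
      let j , Dj≤q = limit≤open (coordinate-Join-of o zero) (≤q zero)
      in C.trans (h {D j ▹ ⟨⟩} ( (λ { zero → C.trans (p≤ zero) (limit≤D j) })
                              , (λ { zero → Dj≤q }))) (¬D≤colimit j)
      where open Power 1

    -- Being above `limit` in the order of a coordinate; at a dual coordinate `colimit` takes the
    -- place of the complement of `limit`.
    Bounds : Polarity → C.Carrier → Set ℓ
    Bounds direct x = limit C.≤ x
    Bounds dual   x = x C.≤ colimit

    -- In the direct case the lower end is the closed vector with `limit` at `i` and `⊥` elsewhere,
    -- so the bound on `xs i` is enough to place it below `xs`. A vector `v` of the algebra above it
    -- has `v i` above some `D k` by compactness, and the hypothesis then bounds `f v`. The dual
    -- case uses an open upper end in the same way.
    limit≤σ : ∀ {n} (p : Polarity) (f : Vector Carrier n → Carrier) (i : Fin n) →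
      (∀ {v k} → lit p (D k) ⊑[ p ] v i → ∃[ j ] D j ≤ f v) →
      ∀ {xs} → Bounds p (xs i) → limit C.≤ OperationExtension.σ-extension κ n f xs
    limit≤σ {n} direct f i h {xs} l =
      σ-upper f {p = ⋀ᵛ X} {q = eᵛ (const ⊤)} (X , P.Eq.refl) (eᵛ-Open _) below (λ _ → ≤e⊤)
        λ {v} (p , _) →
          let k , q = limit≤e (C.trans (proj₂ (coordinate-Meet-of (X , P.Eq.refl) i) limit
                        λ { (w , (k , r) , w≈a) → C.trans (limit≤D k)
                              (C.trans (e-mono r) (C.reflexive (e-cong w≈a))) }) (p i))
              j , r = h {v} {k} q
          in C.trans (limit≤D j) (e-mono r)
      where
      open Power n
      X : Pred (Vector Carrier n) ℓ
      X v = ∃[ k ] D k ≤ v i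
      X-update : ∀ k → X (updateAt (const ⊥) i (const (D k)))
      X-update k = k , ≤-reflexive (≡.subst (D k ≈_) (≡.sym (updateAt-updates i _)) refl)
      below-update : ∀ k → ⋀ᵛ X P.≤ eᵛ (updateAt (const ⊥) i (const (D k)))
      below-update k = proj₁ (P.⋀-glb _) _ (lift (_ , X-update k , P.Eq.refl))
      below : ⋀ᵛ X P.≤ xs
      below j with j ≟ i
      ... | yes ≡.refl = C.trans (proj₂ (⋀-Meet-of chain) _ λ { (k , a≈Dk) →
              C.trans (below-update k j) (C.reflexive (e-cong
                (≡.subst (_≈ _) (≡.sym (updateAt-updates i _)) (sym a≈Dk)))) }) l
      -- Away from `i` the vector is `⊥` for every index of the chain; 0 is an arbitrary choice.
      ... | no j≢i = C.trans (below-update 0 j)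
              (≡.subst (λ a → e a C.≤ xs j) (≡.sym (updateAt-minimal j i _ j≢i)) e⊥≤)
    limit≤σ {n} dual f i h {xs} l =
      σ-upper f {p = eᵛ (const ⊥)} {q = ⋁ᵛ Y} (eᵛ-Closed _) (Y , P.Eq.refl) (λ _ → e⊥≤) above
        λ {v} (_ , q) →
          let k , q = e≤colimit (C.trans (q i) (proj₂ (coordinate-Join-of (Y , P.Eq.refl) i) colimit
                        λ { (w , (k , r) , w≈a) → C.trans (C.reflexive (e-cong (sym w≈a)))
                              (C.trans (e-mono r) (¬D≤colimit k)) }))
              j , r = h {v} {k} q
          in C.trans (limit≤D j) (e-mono r)
      where
      open Power n
      Y : Pred (Vector Carrier n) ℓ
      Y v = ∃[ k ] v i ≤ ¬ D k
      Y-update : ∀ k → Y (updateAt (const ⊤) i (const (¬ D k)))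
      Y-update k = k , ≤-reflexive (≡.subst (_≈ ¬ D k) (≡.sym (updateAt-updates i _)) refl)
      above-update : ∀ k → eᵛ (updateAt (const ⊤) i (const (¬ D k))) P.≤ ⋁ᵛ Y
      above-update k = proj₁ (P.⋁-lub _) _ (lift (_ , Y-update k , P.Eq.refl))
      above : xs P.≤ ⋁ᵛ Y
      above j with j ≟ i
      ... | yes ≡.refl = C.trans l (proj₂ (⋁-Join-of cochain) _ λ { (k , a≈¬Dk) →
              C.trans (C.reflexive (e-cong (≡.subst (_ ≈_) (≡.sym (updateAt-updates i _)) a≈¬Dk)))
                (above-update k j) })
      ... | no j≢i = C.trans
              (≡.subst (λ a → xs j C.≤ e a) (≡.sym (updateAt-minimal j i _ j≢i)) ≤e⊤)
              (above-update 0 j)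

-- Coherence forces the iterates of step to stabilise

generated-eval : ∀ {o c ℓ} {S : Signature o} (A : Algebra S c ℓ) (L : List (Algebra.Carrier A)) →
                 ∀ {x} → Generated A L x → ∃[ t ] Algebra._≈_ A (eval A (lookup L) t) x
generated-eval A L (generator x∈L) =
  var (index x∈L) , Algebra.reflexive A (≡.sym (lookup-index x∈L))
generated-eval A L (closed f gs)  =
  app f (proj₁ ∘ generated-eval A L ∘ gs) , Algebra.op-cong A f (proj₂ ∘ generated-eval A L ∘ gs)
generated-eval A L (respects p g) =
  let t , q = generated-eval A L g in t , Algebra.trans A q p

vector-bound : ∀ {n} (ks : Vector ℕ n) → ∃[ k ] (∀ i → ks i ℕ.≤ k)
vector-bound {zero}  ks = 0 , λ ()
vector-bound {suc n} ks =
  let k , p = vector-bound (ks ∘ suc)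
  in ks zero ℕ.⊔ k , λ { zero → ℕ.m≤m⊔n _ k ; (suc i) → ℕ.≤-trans (p i) (ℕ.m≤n⊔m (ks zero) k) }

module Translation {ℓ : Level} (V : BAOVariety ℓ) {m : ℕ} (O′ : TermFamily V m) where
  open BAOVariety V

  translate : ∀ {X} → Term (withBool (familySignature V O′)) X → Term (withBool signature) X
  translate (var x)           = var x
  translate (app (inj₁ f) ts) = app (inj₁ f) (λ i → translate (ts i))
  translate (app (inj₂ j) ts) = substitute (λ i → translate (ts i)) (proj₂ (O′ j))

  eval-translate : ∀ (A : Algebra (withBool signature) ℓ ℓ) {X : Set} (ρ : X → Algebra.Carrier A) t →
    Algebra._≈_ A (eval A ρ (translate t)) (eval (termReduct V O′ A) ρ t)
  eval-translate A ρ (var x)           = Algebra.refl A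
  eval-translate A ρ (app (inj₁ f) ts) = Algebra.op-cong A (inj₁ f) (λ i → eval-translate A ρ (ts i))
  eval-translate A ρ (app (inj₂ j) ts) = Algebra.trans A
    (eval-substitute A ρ (λ i → translate (ts i)) (proj₂ (O′ j)))
    (eval-cong A (λ i → eval-translate A ρ (ts i)) (proj₂ (O′ j)))

module Stabilisation {ℓ : Level} (em : ExcludedMiddle (lsuc ℓ)) (V : BAOVariety ℓ)
  (canonical : ClosedUnderCanonicalExtensions V) {m : ℕ} (O′ : TermFamily V m)
  (expanding : ∀ j → IsExpanding V (proj₂ (O′ j)))
  (π′ : Polarities (familySignature V O′))
  (isBAO′ : ∀ A → BAOVariety.Members V A → IsBAO π′ (termReduct V O′ A)) where

  open BAOVariety V
  open Translation V O′

  Σ′ = withBool (familySignature V O′)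

  module Reduct (A : Algebra (withBool signature) ℓ ℓ) (A∈V : Members A) where
    algebra = termReduct V O′ A
    open FiniteBAOProperties π′ algebra (isBAO′ A A∈V) public

    below⇒≤ : ∀ {X : Set} (ρ : X → Carrier) s t →
      eval A ρ (translate s) ≈ eval A ρ (translate (s ∧ₜ t)) → eval algebra ρ s ≤ eval algebra ρ t
    below⇒≤ ρ s t p = trans (sym (eval-translate A ρ s)) (trans p
      (trans (eval-translate A ρ (s ∧ₜ t)) (EvalBool.eval-∧ algebra ρ s t)))

    ≤⇒below : ∀ {X : Set} (ρ : X → Carrier) s t →
      eval algebra ρ s ≤ eval algebra ρ t → eval A ρ (translate s) ≈ eval A ρ (translate (s ∧ₜ t))
    ≤⇒below ρ s t p = trans (eval-translate A ρ s) (trans p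
      (trans (sym (EvalBool.eval-∧ algebra ρ s t)) (sym (eval-translate A ρ (s ∧ₜ t)))))

    eval-at : ∀ {X : Set} (ρ : X → Carrier) x (t : Term Σ′ Unit) →
      eval algebra ρ (substitute (const (var x)) t) ≈ eval algebra (const (ρ x)) t
    eval-at ρ x t = eval-substitute algebra ρ (const (var x)) t

  powAt : ∀ {X : Set} → X → ℕ → Term Σ′ X
  powAt x k = substitute (const (var x)) (powₜ π′ k)

  module Limits (B : Algebra (withBool signature) ℓ ℓ) (B∈V : Members B) where
    private isBoolean = isBooleanMember B B∈V
    open CanonicalExtensionConstruction em B isBoolean using (canonicalExtension)
    κ = proj₁ canonicalExtension
    open CanonicalExtension κ using () renaming (embed to e) public
    open CanonicalProperties extension B isBoolean κ (proj₂ canonicalExtension) public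
      hiding (Aσ; module Aσ)

    Bσ : Algebra (withBool signature) ℓ ℓ
    Bσ = canonicalAlgebra extension B isBoolean κ

    Bσ∈V : Members Bσ
    Bσ∈V = canonical B B∈V κ

    module R  = Reduct B B∈V
    module Rσ = Reduct Bσ Bσ∈V

    module _ (x : Algebra.Carrier B) where
      open Limit (λ k → R.pow k x) (λ {j} {k} j≤k → R.pow-anti j k x (≤⇒≤′ j≤k)) public

      private
        limit-Bounds : ∀ p → Bounds p (Rσ.lit p limit)
        limit-Bounds direct = C.refl
        limit-Bounds dual   = ¬limit≤colimit

        module B = BooleanReduct B isBoolean

        reduct-⊑ : ∀ p {u w} → B.lit p u B.⊑[ p ] w → R.lit p u R.⊑[ p ] w
        reduct-⊑ direct q = q
        reduct-⊑ dual   q = q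

      -- Compactness puts `limit` below the σ-extension of the term operation at these slots, and
      -- the term being expanding carries this over to its evaluation in `Bσ`.
      limit≤box : ∀ j i → limit C.≤ Rσ.box j i limit
      limit≤box j i = C.trans
        (limit≤σ (π′ j i) (λ as → eval B as (proj₂ (O′ j))) i
          -- The index grows by one because `pow (suc k) x` is below every box of `pow k x`.
          (λ {v} {k} p → suc k , R.≤-trans (R.≤-reflexive (R.pow-suc k x))
            (R.≤-trans (R.step≤box _ j i) (R.op-mono j (R.slots-least (π′ j) i v (reduct-⊑ (π′ j i) p)))))
          {Rσ.slots (π′ j) i limit}
          (≡.subst (Bounds (π′ j i)) (≡.sym (updateAt-updates i _)) (limit-Bounds (π′ j i))))
        (expanding j B B∈V κ (Rσ.slots (π′ j) i limit))

      limit≤step : limit Rσ.≤ Rσ.step limit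
      limit≤step = Rσ.step-greatest Rσ.≤-refl
        λ j i → closed-∧σ (⋀-Meet-of chain) (limit≤box j i)

      limit≤x : limit Rσ.≤ e x
      limit≤x = closed-∧σ (⋀-Meet-of chain) (limit≤D 0)

      ≤limit : ∀ {z} → (∀ k → z R.≤ R.pow k x) → e z Rσ.≤ limit
      ≤limit p = closed-∧σ (e-Meet-of _) (proj₂ (⋀-Meet-of chain) _ λ { (k , a≈) →
        e-mono (R.≤-trans (p k) (R.≤-reflexive (R.sym a≈))) })

  -- The presentations on `x`, `z`, `y` and on `x`, `z`.

  x₂ z₂ : Fin 2
  x₂ = zero
  z₂ = suc zero

  x₃ z₃ y₃ : Fin 3
  x₃ = zero
  z₃ = suc zero
  y₃ = suc (suc zero)

  inequality : ∀ {X : Set} → Term Σ′ X → Term Σ′ X →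
               Term (withBool signature) X × Term (withBool signature) X
  inequality s t = translate s , translate (s ∧ₜ t)

  relations : List (Term (withBool signature) (Fin 3) × Term (withBool signature) (Fin 3))
  relations = inequality (var z₃) (var y₃)
            ∷ inequality (var y₃) (var x₃)
            ∷ inequality (var y₃) (substitute (const (var y₃)) (stepₜ π′))
            ∷ []

  A₃ : Algebra (withBool signature) ℓ ℓ
  A₃ = quotient (Free theory (Fin 3)) (pairs (Free theory (Fin 3)) relations)

  A₃∈V : Members A₃
  A₃∈V = presented-Mod theory _

  generators : List (Term (withBool signature) (Fin 3))
  generators = var x₃ ∷ var z₃ ∷ []

  data Chain : Rel (Term (withBool signature) (Fin 2)) ℓ where
    below : ∀ k → Chain (proj₁ (inequality (var z₂) (powAt x₂ k)))
                        (proj₂ (inequality (var z₂) (powAt x₂ k)))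

  B₂ : Algebra (withBool signature) ℓ ℓ
  B₂ = quotient (Free theory (Fin 2)) Chain

  B₂∈V : Members B₂
  B₂∈V = presented-Mod theory _

  module A₃ = Reduct A₃ A₃∈V

  A₃-below : ∀ k → eval A₃ (lookup generators) (proj₁ (inequality (var z₂) (powAt x₂ k))) A₃.≈
                   eval A₃ (lookup generators) (proj₂ (inequality (var z₂) (powAt x₂ k)))
  A₃-below k = A₃.≤⇒below (lookup generators) (var z₂) (powAt x₂ k)
    (A₃.≤-trans z≤y (A₃.≤-trans (A₃.postfixpoint≤pow y≤x y≤step k)
      (A₃.≤-reflexive (A₃.sym (A₃.eval-at (lookup generators) x₂ (powₜ π′ k))))))
    where
    holds : ∀ {s t} → (s , t) ∈ relations → eval A₃ var s A₃.≈ eval A₃ var t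
    holds i = A₃.trans (eval-presented-var theory _ _)
      (A₃.trans (base i) (A₃.sym (eval-presented-var theory _ _)))
    z≤y : var z₃ A₃.≤ var y₃
    z≤y = A₃.below⇒≤ var (var z₃) (var y₃) (holds (here ≡.refl))
    y≤x : var y₃ A₃.≤ var x₃
    y≤x = A₃.below⇒≤ var (var y₃) (var x₃) (holds (there (here ≡.refl)))
    y≤step : var y₃ A₃.≤ A₃.step (var y₃)
    y≤step = A₃.≤-trans
      (A₃.below⇒≤ var (var y₃) (substitute (const (var y₃)) (stepₜ π′)) (holds (there (there (here ≡.refl)))))
      (A₃.≤-reflexive (A₃.eval-at var y₃ (stepₜ π′)))

  -- In the canonical extension of B₂ the variable y can be interpreted by the
  -- meet of all pow k x.
  A₃⇒B₂ : ∀ s t → eval A₃ (lookup generators) s A₃.≈ eval A₃ (lookup generators) t →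
          Algebra._≈_ B₂ s t
  A₃⇒B₂ s t p = transit (symmetric (eval-presented-var theory Chain s))
    (transit (e-injective (C.Eq.trans (toBσ s) (C.Eq.trans
      (Cg-sound Bσ Bσ∈V ρ satisfied p) (C.Eq.sym (toBσ t)))))
      (eval-presented-var theory Chain t))
    where
    open Limits B₂ B₂∈V
    ρ : Fin 3 → C.Carrier
    ρ = e (var x₂) ▹ e (var z₂) ▹ limit (var x₂) ▹ ⟨⟩
    z≤pow : ∀ k → var z₂ R.≤ R.pow k (var x₂)
    z≤pow k = R.≤-trans (R.below⇒≤ var (var z₂) (powAt x₂ k)
        (R.trans (eval-presented-var theory Chain _)
          (R.trans (base (below k)) (R.sym (eval-presented-var theory Chain _)))))
      (R.≤-reflexive (R.eval-at var x₂ (powₜ π′ k)))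
    satisfied : ∀ {s t} → (s , t) ∈ relations → eval Bσ ρ s C.≈ eval Bσ ρ t
    satisfied (here ≡.refl) = Rσ.≤⇒below ρ (var z₃) (var y₃) (≤limit (var x₂) z≤pow)
    satisfied (there (here ≡.refl)) = Rσ.≤⇒below ρ (var y₃) (var x₃) (limit≤x (var x₂))
    satisfied (there (there (here ≡.refl))) =
      Rσ.≤⇒below ρ (var y₃) (substitute (const (var y₃)) (stepₜ π′))
        (Rσ.≤-trans (limit≤step (var x₂)) (Rσ.≤-reflexive (Rσ.sym (Rσ.eval-at ρ y₃ (stepₜ π′)))))
    -- On terms in `x` and `z` the embedding of `B₂` agrees with the homomorphism from `A₃` given by
    -- `ρ`; as `e` is injective, equations of `A₃` come back to `B₂`.
    toBσ : ∀ u → e (eval B₂ var u) C.≈ eval Bσ ρ (eval A₃ (lookup generators) u)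
    toBσ u = C.Eq.trans (eval-homomorphic B₂ Bσ e e-homomorphic var u)
      (C.Eq.trans (eval-cong Bσ (λ { zero → C.Eq.refl ; (suc zero) → C.Eq.refl }) u)
        (C.Eq.sym (eval-homomorphic A₃ Bσ (eval Bσ ρ) (λ f xs → C.Eq.refl) (lookup generators) u)))

  -- `pow k c` is the largest value of `z` that satisfies the chain relations up to index `k`.
  HoldsAt : ℕ → Rel (Term (withBool signature) (Fin 2)) (lsuc ℓ)
  HoldsAt k s t = ∀ C (C∈V : Members C) c →
    let ρ = c ▹ Reduct.pow C C∈V k c ▹ ⟨⟩ in Algebra._≈_ C (eval C ρ s) (eval C ρ t)

  Eventually : Rel (Term (withBool signature) (Fin 2)) (lsuc ℓ)
  Eventually s t = ∃[ K ] (∀ k → K ℕ.≤ k → HoldsAt k s t)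

  -- Induction on the derivation: a chain relation of index `j` holds from stage `j` on, and each
  -- rule has finitely many premises, operations having finite arity.
  B₂⇒Eventually : ∀ {s t} → Algebra._≈_ B₂ s t → Eventually s t
  B₂⇒Eventually (base (below j)) = j , λ k j≤k C C∈V c →
    let open Reduct C C∈V
        ρ = c ▹ pow k c ▹ ⟨⟩
    in ≤⇒below ρ (var z₂) (powAt x₂ j) (≤-trans (pow-anti j k c (≤⇒≤′ j≤k))
         (≤-reflexive (sym (eval-at ρ x₂ (powₜ π′ j)))))
  B₂⇒Eventually (equal p)     = 0 , λ k _ C C∈V c → Derivable-sound C C∈V p _
  B₂⇒Eventually (symmetric p) =
    let K , h = B₂⇒Eventually p in K , λ k l C C∈V c → Algebra.sym C (h k l C C∈V c)
  B₂⇒Eventually (transit p q) =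
    let K , h = B₂⇒Eventually p
        L , g = B₂⇒Eventually q
    in K ℕ.⊔ L , λ k l C C∈V c → Algebra.trans C
         (h k (ℕ.≤-trans (ℕ.m≤m⊔n K L) l) C C∈V c) (g k (ℕ.≤-trans (ℕ.m≤n⊔m K L) l) C C∈V c)
  B₂⇒Eventually (compat f ps) =
    let hs    = λ i → B₂⇒Eventually (ps i)
        K , b = vector-bound (proj₁ ∘ hs)
    in K , λ k l C C∈V c → Algebra.op-cong C f (λ i → proj₂ (hs i) k (ℕ.≤-trans (b i) l) C C∈V c)

  All-Eventually : ∀ {T : Set ℓ} (f : T → Term (withBool signature) (Fin 2)) {L : List (T × T)} →
                   (∀ {s t} → (s , t) ∈ L → Eventually (f s) (f t)) →
                   ∃[ K ] (∀ k → K ℕ.≤ k → ∀ {s t} → (s , t) ∈ L → HoldsAt k (f s) (f t))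
  All-Eventually f {[]}    h = 0 , λ _ _ ()
  All-Eventually f {_ ∷ L} h =
    let K , p = h (here ≡.refl)
        M , q = All-Eventually f {L} (h ∘ there)
    in K ℕ.⊔ M , λ { k l (here ≡.refl) → p k (ℕ.≤-trans (ℕ.m≤m⊔n K M) l)
                   ; k l (there i)     → q k (ℕ.≤-trans (ℕ.m≤n⊔m K M) l) i }

  -- Once the relations `L` hold at stage `K`, `ρ′` induces a homomorphism from the presented
  -- algebra to every member `C`. It sends `x` to `c` and `z` to `pow K c`, and takes along the
  -- inequality `z ≤ pow (suc K) x` inherited from `A₃`.
  stabilises : Coherent theory →
    ∃[ K ] (∀ C (C∈V : Members C) c → let open Reduct C C∈V in pow K c ≤ pow (suc K) c)
  stabilises coherent with coherent A₃ A₃∈V (3 , relations , ≅-refl A₃) generators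
  ... | n , L , iso = K , conclusion
    where
    Sub = subalgebra A₃ generators
    Q   = quotient (Free theory (Fin n)) (pairs (Free theory (Fin n)) L)
    module Q = Algebra Q
    module Sub = Algebra Sub
    open _≅_ iso using (to; bijection; homomorphic)
    open Bijection bijection using (injective; strictlySurjective; cong)

    to-eval : ∀ {X : Set} (ρ : X → Sub.Carrier) t → to (eval Sub ρ t) Q.≈ eval Q (to ∘ ρ) t
    to-eval = eval-homomorphic Sub Q to homomorphic

    Sub-eval : ∀ {X : Set} (ρ : X → Sub.Carrier) t → proj₁ (eval Sub ρ t) A₃.≈ eval A₃ (proj₁ ∘ ρ) t
    Sub-eval = eval-homomorphic Sub A₃ proj₁ (λ f xs → A₃.refl)

    g : Fin n → Sub.Carrier
    g i = proj₁ (strictlySurjective (var i))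

    -- The generators of Q, as terms in x and z.
    r : Fin n → Term (withBool signature) (Fin 2)
    r i = proj₁ (generated-eval A₃ generators (proj₂ (g i)))

    gen : Fin 2 → Sub.Carrier
    gen zero       = var x₃ , generator (here ≡.refl)
    gen (suc zero) = var z₃ , generator (there (here ≡.refl))

    to-g : ∀ t → to (eval Sub g t) Q.≈ t
    to-g t = Q.trans (to-eval g t)
      (Q.trans (eval-cong Q (λ i → proj₂ (strictlySurjective (var i))) t)
        (eval-presented-var theory _ t))

    Sub-r : ∀ t → eval A₃ (lookup generators) (substitute r t) A₃.≈ proj₁ (eval Sub g t)
    Sub-r t = A₃.trans (eval-substitute A₃ _ r t)
      (A₃.trans (eval-cong A₃ (λ i → proj₂ (generated-eval A₃ generators (proj₂ (g i)))) t)
        (A₃.sym (Sub-eval g t)))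

    relation-Eventually : ∀ {s t} → (s , t) ∈ L → Eventually (substitute r s) (substitute r t)
    relation-Eventually {s} {t} i = B₂⇒Eventually (A₃⇒B₂ (substitute r s) (substitute r t) (A₃.trans (Sub-r s)
      (A₃.trans (injective (Q.trans (to-g s) (Q.trans (base i) (Q.sym (to-g t))))) (A₃.sym (Sub-r t)))))

    gen-lookup : ∀ i → proj₁ (gen i) A₃.≈ lookup generators i
    gen-lookup zero       = A₃.refl
    gen-lookup (suc zero) = A₃.refl

    -- `to (gen i)` writes `x` or `z` in the generators of `Q`, and `r` writes those in `x` and `z`
    -- again. The round trip is the identity in `A₃`, hence at all late stages.
    generator-Eventually : ∀ i → Eventually (substitute r (to (gen i))) (var i)
    generator-Eventually i = B₂⇒Eventually (A₃⇒B₂ (substitute r (to (gen i))) (var i) (A₃.trans (Sub-r (to (gen i)))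
      (A₃.trans (injective (to-g (to (gen i)))) (gen-lookup i))))

    relations-bound  = All-Eventually (substitute r) relation-Eventually
    generators-bound = vector-bound (proj₁ ∘ generator-Eventually)

    K : ℕ
    K = proj₁ relations-bound ℕ.⊔ proj₁ generators-bound

    -- In `A₃` the chain inequalities hold at every index; the first index beyond `K` is the one
    -- that says something new at `z = pow K c`.
    w w′ : Term (withBool signature) (Fin 2)
    w  = proj₁ (inequality (var z₂) (powAt x₂ (suc K)))
    w′ = proj₂ (inequality (var z₂) (powAt x₂ (suc K)))

    to-below : eval Q (to ∘ gen) w Q.≈ eval Q (to ∘ gen) w′
    to-below = Q.trans (Q.sym (to-eval gen w)) (Q.trans (cong (A₃.trans (Sub-gen w)
      (A₃.trans (A₃-below (suc K)) (A₃.sym (Sub-gen w′))))) (to-eval gen w′))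
      where
      Sub-gen : ∀ t → proj₁ (eval Sub gen t) A₃.≈ eval A₃ (lookup generators) t
      Sub-gen t = A₃.trans (Sub-eval gen t) (eval-cong A₃ gen-lookup t)

    conclusion : ∀ C (C∈V : Members C) c → let open Reduct C C∈V in pow K c ≤ pow (suc K) c
    conclusion C C∈V c = ≤-trans
      (below⇒≤ ρ (var z₂) (powAt x₂ (suc K)) (trans (sym (toC-gen w)) (trans
        (Cg-sound C C∈V ρ′ (λ {s} {t} → satisfied {s} {t}) to-below) (toC-gen w′))))
      (≤-reflexive (eval-at ρ x₂ (powₜ π′ (suc K))))
      where
      open Reduct C C∈V
      ρ : Fin 2 → Carrier
      ρ = c ▹ pow K c ▹ ⟨⟩
      ρ′ : Fin n → Carrier
      ρ′ = eval C ρ ∘ r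
      satisfied : ∀ {s t} → (s , t) ∈ L → eval C ρ′ s ≈ eval C ρ′ t
      satisfied {s} {t} i = trans (sym (eval-substitute C ρ r s)) (trans
        (proj₂ relations-bound K (ℕ.m≤m⊔n (proj₁ relations-bound) _) i C C∈V c)
        (eval-substitute C ρ r t))
      ρ′-gen : ∀ i → eval C ρ′ (to (gen i)) ≈ ρ i
      ρ′-gen i = trans (sym (eval-substitute C ρ r (to (gen i)))) (proj₂ (generator-Eventually i) K
        (ℕ.≤-trans (proj₂ generators-bound i) (ℕ.m≤n⊔m (proj₁ relations-bound) _)) C C∈V c)
      toC-gen : ∀ t → eval C ρ′ (eval Q (to ∘ gen) t) ≈ eval C ρ t
      toC-gen t = trans (eval-homomorphic Q C (eval C ρ′) (λ f xs → refl) (to ∘ gen) t)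
        (eval-cong C ρ′-gen t)

-- Identities in the variety generated by the term reducts

data Expression : Set where
  atom    : ℕ → Expression
  _&_ _∣_ : Expression → Expression → Expression
  neg     : Expression → Expression
  true false : Expression

module _ {o : Level} {S : Signature o} where

  expressionₜ : Expression → Term (withBool S) ℕ
  expressionₜ (atom n)  = var n
  expressionₜ (s & t) = expressionₜ s ∧ₜ expressionₜ t
  expressionₜ (s ∣ t)  = expressionₜ s ∨ₜ expressionₜ t
  expressionₜ (neg t)   = ¬ₜ expressionₜ t
  expressionₜ true      = ⊤ₜ
  expressionₜ false     = ⊥ₜ

  module _ {c ℓ} (A : Algebra (withBool S) c ℓ) (ρ : ℕ → Algebra.Carrier A) where
    open Algebra A
    open BoolOps A
    open BoolCong A
    open EvalBool A ρ

    -- `eval` applies `op` to a vector that agrees with `x ▹ y ▹ ⟨⟩` only pointwise; here the binary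
    -- operations themselves occur, so the Boolean laws apply as they stand.
    evaluate : Expression → Carrier
    evaluate (atom n)  = ρ n
    evaluate (s & t) = evaluate s ∧ evaluate t
    evaluate (s ∣ t)  = evaluate s ∨ evaluate t
    evaluate (neg t)   = ¬ evaluate t
    evaluate true      = ⊤
    evaluate false     = ⊥

    eval-expression : ∀ t → eval A ρ (expressionₜ t) ≈ evaluate t
    eval-expression (atom n)  = refl
    eval-expression (s & t) = trans (eval-∧ _ _) (∧-congruent (eval-expression s) (eval-expression t))
    eval-expression (s ∣ t)  = trans (eval-∨ _ _) (∨-congruent (eval-expression s) (eval-expression t))
    eval-expression (neg t)   = trans (eval-¬ _) (¬-congruent (eval-expression t))
    eval-expression true      = eval-⊤
    eval-expression false     = eval-⊥

  meetₜ : ∀ {X : Set} → Polarity → Term (withBool S) X → Term (withBool S) X → Term (withBool S) X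
  meetₜ direct = _∧ₜ_
  meetₜ dual   = _∨ₜ_

  unitₜ : ∀ {X : Set} → Polarity → Term (withBool S) X
  unitₜ direct = ⊤ₜ
  unitₜ dual   = ⊥ₜ

  module _ {c ℓ} (A : Algebra (withBool S) c ℓ) {X : Set} (ρ : X → Algebra.Carrier A) where
    open Algebra A

    eval-meet : ∀ p s t → eval A ρ (meetₜ p s t) ≈ meet A p (eval A ρ s) (eval A ρ t)
    eval-meet direct = EvalBool.eval-∧ A ρ
    eval-meet dual   = EvalBool.eval-∨ A ρ

    eval-unit : ∀ p → eval A ρ (unitₜ p) ≈ unit A p
    eval-unit direct = EvalBool.eval-⊤ A ρ
    eval-unit dual   = EvalBool.eval-⊥ A ρ

assign : ∀ {a} {A : Set a} → A → A → A → ℕ → A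
assign x y z 0 = x
assign x y z 1 = y
assign x y z _ = z

extend : ∀ {a n} {A : Set a} → Vector A n → A → ℕ → A
extend {n = zero}  xs x k       = x
extend {n = suc n} xs x zero    = xs zero
extend {n = suc n} xs x (suc k) = extend (xs ∘ suc) x k

extend-toℕ : ∀ {a n} {A : Set a} (xs : Vector A n) x i → extend xs x (toℕ i) ≡ xs i
extend-toℕ xs x zero    = ≡.refl
extend-toℕ xs x (suc i) = extend-toℕ (xs ∘ suc) x i

module GeneratedVariety {o c ℓ k} {S : Signature o} {K : Algebra (withBool S) c ℓ → Set k}
  (B : Algebra (withBool S) c ℓ) (B∈ : VarietyGeneratedBy K B) where
  open Algebra B
  open BoolOps B

  -- Membership in the generated variety is tested on the theory whose only identity is `s ≈ t`.
  identity-holds : ∀ s t → (∀ A → K A → ∀ ρ → Algebra._≈_ A (eval A ρ s) (eval A ρ t)) →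
                   ∀ ρ → eval B ρ s ≈ eval B ρ t
  identity-holds s t h ρ =
    B∈ (λ s′ t′ → Lift (o ⊔ c ⊔ ℓ) (Lift o (s′ ≡ s × t′ ≡ t)))
      (λ { A A∈K _ _ (lift (lift (≡.refl , ≡.refl))) → h A A∈K }) s t (lift (lift (≡.refl , ≡.refl))) ρ

  module _ (isBoolean : ∀ A → K A → IsBoolean A) where

    law : ∀ s t → (∀ A → IsBoolean A → ∀ ρ → Algebra._≈_ A (evaluate A ρ s) (evaluate A ρ t)) →
          ∀ x y z → evaluate B (assign x y z) s ≈ evaluate B (assign x y z) t
    law s t h x y z = trans (sym (eval-expression B (assign x y z) s)) (trans
      (identity-holds (expressionₜ s) (expressionₜ t)
        (λ A A∈K ρ → Algebra.trans A (eval-expression A ρ s)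
          (Algebra.trans A (h A (isBoolean A A∈K) ρ) (Algebra.sym A (eval-expression A ρ t))))
        (assign x y z))
      (eval-expression B (assign x y z) t))

    generated-isBoolean : IsBoolean B
    generated-isBoolean = record
      { isDistributiveLattice = record
        { isLattice = record
          { isEquivalence = isEquivalence
          ; ∨-comm  = λ x y → law (a ∣ b) (b ∣ a) (λ A β ρ → IsBooleanAlgebra.∨-comm β _ _) x y y
          ; ∨-assoc = law ((a ∣ b) ∣ c′) (a ∣ (b ∣ c′)) (λ A β ρ → IsBooleanAlgebra.∨-assoc β _ _ _)
          ; ∨-cong  = BoolCong.∨-congruent B
          ; ∧-comm  = λ x y → law (a & b) (b & a) (λ A β ρ → IsBooleanAlgebra.∧-comm β _ _) x y y
          ; ∧-assoc = law ((a & b) & c′) (a & (b & c′)) (λ A β ρ → IsBooleanAlgebra.∧-assoc β _ _ _)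
          ; ∧-cong  = BoolCong.∧-congruent B
          ; absorptive =
              (λ x y → law (a ∣ (a & b)) a (λ A β ρ → IsBooleanAlgebra.∨-absorbs-∧ β _ _) x y y) ,
              (λ x y → law (a & (a ∣ b)) a (λ A β ρ → IsBooleanAlgebra.∧-absorbs-∨ β _ _) x y y)
          }
        ; ∨-distrib-∧ =
            law (a ∣ (b & c′)) ((a ∣ b) & (a ∣ c′)) (λ A β ρ → IsBooleanAlgebra.∨-distribˡ-∧ β _ _ _) ,
            law ((b & c′) ∣ a) ((b ∣ a) & (c′ ∣ a)) (λ A β ρ → IsBooleanAlgebra.∨-distribʳ-∧ β _ _ _)
        ; ∧-distrib-∨ =
            law (a & (b ∣ c′)) ((a & b) ∣ (a & c′)) (λ A β ρ → IsBooleanAlgebra.∧-distribˡ-∨ β _ _ _) ,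
            law ((b ∣ c′) & a) ((b & a) ∣ (c′ & a)) (λ A β ρ → IsBooleanAlgebra.∧-distribʳ-∨ β _ _ _)
        }
      ; ∨-complement =
          (λ x → law ((neg a) ∣ a) true (λ A β ρ → IsBooleanAlgebra.∨-complementˡ β _) x x x) ,
          (λ x → law (a ∣ (neg a)) true (λ A β ρ → IsBooleanAlgebra.∨-complementʳ β _) x x x)
      ; ∧-complement =
          (λ x → law ((neg a) & a) false (λ A β ρ → IsBooleanAlgebra.∧-complementˡ β _) x x x) ,
          (λ x → law (a & (neg a)) false (λ A β ρ → IsBooleanAlgebra.∧-complementʳ β _) x x x)
      ; ¬-cong = BoolCong.¬-congruent B
      }
      where
      a b c′ : Expression
      a  = atom 0
      b  = atom 1
      c′ = atom 2

  module _ (f : Op S) (p : Fin (arity S f) → Polarity)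
           (isOperator : ∀ A → K A → IsOperator A p (Algebra.op A (inj₂ f))) where

    private
      vars : Vector (Term (withBool S) ℕ) (arity S f)
      -- The indices 0 and 1 are kept for the two values placed in the distinguished coordinate.
      vars i = var (suc (suc (toℕ i)))

      at : Fin (arity S f) → Term (withBool S) ℕ → Term (withBool S) ℕ
      at i t = app (inj₂ f) (updateAt vars i (const t))

      eval-at : ∀ (A : Algebra (withBool S) c ℓ) ρ i t → Algebra._≈_ A (eval A ρ (at i t))
        (Algebra.op A (inj₂ f) (updateAt (eval A ρ ∘ vars) i (const (eval A ρ t))))
      eval-at A ρ i t = Algebra.op-cong A (inj₂ f) (eval-updateAt A ρ vars i t)

      valuation : Vector Carrier (arity S f) → Carrier → Carrier → ℕ → Carrier
      valuation xs x y 0             = x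
      valuation xs x y 1             = y
      valuation xs x y (suc (suc k)) = extend xs x k

      eval-at-valuation : ∀ xs x y i t {z} → eval B (valuation xs x y) t ≈ z →
        eval B (valuation xs x y) (at i t) ≈ op (inj₂ f) (updateAt xs i (const z))
      eval-at-valuation xs x y i t q = trans (eval-at B (valuation xs x y) i t)
        (op-cong (inj₂ f) (updateAt-cong B (λ k → reflexive (extend-toℕ xs x k)) i q))

    generated-isOperator : IsOperator B p (op (inj₂ f))
    generated-isOperator = record
      { preserves-meet = λ xs i x y →
          let ρ = valuation xs x y
              s = meetₜ (p i) (var 0) (var 1)
          in trans (sym (eval-at-valuation xs x y i s (eval-meet B ρ (p i) (var 0) (var 1))))
            (trans (identity-holds (at i s) (at i (var 0) ∧ₜ at i (var 1)) (meet-law i) ρ)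
              (trans (EvalBool.eval-∧ B ρ _ _) (BoolCong.∧-congruent B
                (eval-at-valuation xs x y i (var 0) refl) (eval-at-valuation xs x y i (var 1) refl))))
      ; preserves-unit = λ xs i →
          let ρ = valuation xs ⊤ ⊤
          in trans (sym (eval-at-valuation xs ⊤ ⊤ i (unitₜ (p i)) (eval-unit B ρ (p i))))
            (trans (identity-holds (at i (unitₜ (p i))) ⊤ₜ (unit-law i) ρ) (EvalBool.eval-⊤ B ρ))
      }
      where
      meet-law : ∀ i A → K A → ∀ ρ → Algebra._≈_ A (eval A ρ (at i (meetₜ (p i) (var 0) (var 1))))
                 (eval A ρ (at i (var 0) ∧ₜ at i (var 1)))
      meet-law i A A∈K ρ = A.trans (eval-at A ρ i _)
        (A.trans (A.op-cong (inj₂ f) (updateAt-cong A (λ _ → A.refl) i (eval-meet A ρ (p i) _ _)))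
          (A.trans (IsOperator.preserves-meet (isOperator A A∈K) _ i _ _)
            (A.sym (A.trans (EvalBool.eval-∧ A ρ _ _)
              (BoolCong.∧-congruent A (eval-at A ρ i (var 0)) (eval-at A ρ i (var 1)))))))
        where module A = Algebra A
      unit-law : ∀ i A → K A → ∀ ρ →
                 Algebra._≈_ A (eval A ρ (at i (unitₜ (p i)))) (eval A ρ ⊤ₜ)
      unit-law i A A∈K ρ = A.trans (eval-at A ρ i _)
        (A.trans (A.op-cong (inj₂ f) (updateAt-cong A (λ _ → A.refl) i (eval-unit A ρ (p i))))
          (A.trans (IsOperator.preserves-unit (isOperator A A∈K) _ i) (A.sym (EvalBool.eval-⊤ A ρ))))
        where module A = Algebra A

  generated-isBAO : ∀ {π : Polarities S} → (∀ A → K A → IsBAO π A) → IsBAO π B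
  generated-isBAO h = record
    { isBoolean  = generated-isBoolean (λ A A∈K → IsBAO.isBoolean (h A A∈K))
    ; isOperator = λ f → generated-isOperator f _ (λ A A∈K → IsBAO.isOperator (h A A∈K) f)
    }

-- Defining principal congruences by one equation.

EDPC-stable : ∀ {c ℓ k m} {ar : Fin m → ℕ} (p′ : Polarities (finiteSignature ar))
  {K : Algebra (withBool (finiteSignature ar)) c ℓ → Set k} (isBAO : ∀ A → K A → IsBAO p′ A) n →
  (∀ A A∈K → let open FiniteBAOProperties p′ A (isBAO A A∈K) in ∀ u → pow n u ≤ pow (suc n) u) →
  EDPC K
EDPC-stable {ar = ar} p′ {K} isBAO n stable = (s , t) ∷ [] , λ A A∈K a b c d → equivalence A A∈K a b c d
  where
  uₜ s t : Term (withBool (finiteSignature ar)) (Fin 4)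
  uₜ = substitute (const ((¬ₜ var zero ∨ₜ var (suc zero)) ∧ₜ (¬ₜ var (suc zero) ∨ₜ var zero))) (powₜ p′ n)
  s  = uₜ ∧ₜ var (suc (suc zero))
  t  = uₜ ∧ₜ var (suc (suc (suc zero)))

  equivalence : ∀ A → K A → let open Algebra A in ∀ a b c d →
    Cg A (pairs A ((a , b) ∷ [])) c d ⇔
      All (λ (p , q) → eval A (a ▹ b ▹ c ▹ d ▹ ⟨⟩) p ≈ eval A (a ▹ b ▹ c ▹ d ▹ ⟨⟩) q) ((s , t) ∷ [])
  equivalence A A∈K a b c d = mk⇔
    (λ p → trans eval-s (trans (Equivalence.to principal p) (sym eval-t)) ∷ [])
    (λ { (p ∷ []) → Equivalence.from principal (trans (sym eval-s) (trans p eval-t)) })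
    where
    open FiniteBAOProperties p′ A (isBAO A A∈K)
    principal = principalCongruence n (stable A A∈K) a b c d
    ρ : Fin 4 → Carrier
    ρ = a ▹ b ▹ c ▹ d ▹ ⟨⟩
    open EvalBool A ρ
    eval-u : eval A ρ uₜ ≈ pow n (a ↔ b)
    eval-u = trans (eval-substitute A ρ _ (powₜ p′ n)) (eval-cong A (λ _ → trans (eval-∧ _ _)
      (∧-cong (trans (eval-∨ _ _) (∨-congʳ (eval-¬ (var zero))))
              (trans (eval-∨ _ _) (∨-congʳ (eval-¬ (var (suc zero))))))) (powₜ p′ n))
    eval-s : eval A ρ s ≈ pow n (a ↔ b) ∧ c
    eval-s = trans (eval-∧ _ _) (∧-congʳ eval-u)
    eval-t : eval A ρ t ≈ pow n (a ↔ b) ∧ d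
    eval-t = trans (eval-∧ _ _) (∧-congʳ eval-u)

theorem5p2 : ∀ {ℓ} → ExcludedMiddle (lsuc ℓ) →
    (V : BAOVariety ℓ) → ClosedUnderCanonicalExtensions V →
    ∀ {m} (O′ : TermFamily V m) → (∀ j → IsExpanding V (proj₂ (O′ j))) →
    (π′ : Polarities (familySignature V O′)) →
    (∀ A → BAOVariety.Members V A → IsBAO π′ (termReduct V O′ A)) →
    Coherent (BAOVariety.theory V) →
    EDPC (ReductVariety V O′)
theorem5p2 {ℓ} em V canonical O′ expanding π′ isBAO′ coherent =
  EDPC-stable π′ isBAO K stable
  where
  open Stabilisation em V canonical O′ expanding π′ isBAO′

  K = proj₁ (stabilises coherent)

  isBAO : ∀ B → ReductVariety V O′ B → IsBAO π′ B
  isBAO B B∈V′ = GeneratedVariety.generated-isBAO B B∈V′ λ { _ (reduct {A} A∈V) → isBAO′ A A∈V }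

  -- The inequality is an identity in the single variable 0, so its validity in the reducts of
  -- members passes to `B`.
  stable : ∀ B B∈V′ → let open FiniteBAOProperties π′ B (isBAO B B∈V′) in
           ∀ u → pow K u ≤ pow (suc K) u
  stable B B∈V′ u = trans (sym (powAt-B K)) (trans
    (GeneratedVariety.identity-holds B B∈V′ (powAt 0 K) (powAt 0 K ∧ₜ powAt 0 (suc K))
      (λ { _ (reduct {A} A∈V) ρ → holds A A∈V ρ }) (const u))
    (trans (EvalBool.eval-∧ B (const u) _ _) (∧-cong (powAt-B K) (powAt-B (suc K)))))
    where
    open FiniteBAOProperties π′ B (isBAO B B∈V′)
    powAt-B : ∀ k → eval B (const u) (powAt 0 k) ≈ pow k u
    powAt-B k = eval-substitute B (const u) (const (var 0)) (powₜ π′ k)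
    holds : ∀ A (A∈V : BAOVariety.Members V A) ρ →
      let R = termReduct V O′ A in
      Algebra._≈_ R (eval R ρ (powAt 0 K)) (eval R ρ (powAt 0 K ∧ₜ powAt 0 (suc K)))
    holds A A∈V ρ = R.trans (R.eval-at ρ 0 (powₜ π′ K)) (R.trans
      (proj₂ (stabilises coherent) A A∈V (ρ 0))
      (R.sym (R.trans (EvalBool.eval-∧ R.algebra ρ _ _)
        (R.∧-cong (R.eval-at ρ 0 (powₜ π′ K)) (R.eval-at ρ 0 (powₜ π′ (suc K)))))))
      where module R = Reduct A A∈V
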